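{- $f(2,d)=d$ for every integer $d\ge 5$.
   Context: All graphs are finite, undirected and simple. A graph is $k$-connected if it has more than $k$ vertices and remains connected after deleting any set of fewer than $k$ vertices. For $F\subseteq E(G)$, $G-F$ denotes the graph obtained from $G$ by deleting the edges in $F$ (keeping all vertices). A matching $M$ (a possibly empty set of pairwise disjoint edges) of a $k$-connected graph $G$ is $k$-removable if $G-M$ is $k$-connected. An $m$-matching is a matching of size $m$. For integers $\delta>k\ge 1$, $f(k,\delta)$ denotes the largest integer $m$ such that every $k$-connected graph $G$ with $|V(G)|\ge 2\delta$ and minimum degree $\delta(G)\ge\delta$ has a $k$-removable $m$-matching. -}

module Defs where

open import Data.Fin.Base using (Fin)
open import Data.Fin.Properties using (_≟_)
open import Data.Fin.Subset using (Subset; _∉_; ∣_∣)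
open import Data.List.Base using (List; length; filter; allFin)
open import Data.List.Membership.Propositional using (_∈_)
import Data.List.Membership.DecPropositional as DecMembership
open import Data.List.Relation.Unary.All using (All)
open import Data.List.Relation.Unary.AllPairs using (AllPairs)
open import Data.Nat.Base using (ℕ; _≤_; _<_; _*_)
open import Data.Product.Base using (Σ-syntax; _×_; _,_; uncurry)
open import Data.Product.Properties using (≡-dec)
open import Data.Sum.Base using (_⊎_; swap)
open import Function.Base using (_∘_)
open import Level using (Level; 0ℓ)
open import Relation.Binary.Construct.Closure.ReflexiveTransitive using (Star)
open import Relation.Binary.Core using (Rel)
open import Relation.Binary.Definitions using (Decidable; Symmetric)
open import Relation.Binary.PropositionalEquality using (_≡_; _≢_)
open import Relation.Nullary.Decidable using (_×-dec_; _⊎-dec_; ¬?)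
open import Relation.Nullary.Negation using (¬_)

record Graph (n : ℕ) : Set₁ where
  field
    Adj        : Rel (Fin n) 0ℓ
    adj?       : Decidable Adj
    adj-sym    : Symmetric Adj
    adj-irrefl : ∀ {v} → ¬ Adj v v

open Graph public

degree : ∀ {n} → Graph n → Fin n → ℕ
degree {n} G v = length (filter (adj? G v) (allFin n))

MinDegree≥ : ∀ {n} → ℕ → Graph n → Set
MinDegree≥ δ G = ∀ v → δ ≤ degree G v

-- Deleting the vertices of S keeps the vertex type Fin n; instead, adjacency
-- and connectedness are restricted to the vertices outside S.
AdjOff : ∀ {n} → Graph n → Subset n → Rel (Fin n) 0ℓ
AdjOff G S u v = u ∉ S × v ∉ S × Adj G u v

ConnectedOff : ∀ {n} → Graph n → Subset n → Set
ConnectedOff G S = ∀ u v → u ∉ S → v ∉ S → Star (AdjOff G S) u v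

-- As ∣ S ∣ < k < n, the graph left after deleting S is never empty.
IsConnected[_] : ∀ {n} → ℕ → Graph n → Set
IsConnected[_] {n} k G = k < n × (∀ (S : Subset n) → ∣ S ∣ < k → ConnectedOff G S)

-- An edge is listed as a pair of its ends, in either order; hence the two
-- orders in EdgeIn.
Pair : ℕ → Set
Pair n = Fin n × Fin n

EdgeIn : ∀ {n} → List (Pair n) → Rel (Fin n) 0ℓ
EdgeIn F u v = (u , v) ∈ F ⊎ (v , u) ∈ F

edgeIn? : ∀ {n} (F : List (Pair n)) → Decidable (EdgeIn F)
edgeIn? F u v = ((u , v) ∈? F) ⊎-dec ((v , u) ∈? F)
  where open DecMembership (≡-dec _≟_ _≟_) using (_∈?_)

_-ᴱ_ : ∀ {n} → Graph n → List (Pair n) → Graph n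
G -ᴱ F = record
  { Adj        = λ u v → Adj G u v × ¬ EdgeIn F u v
  ; adj?       = λ u v → adj? G u v ×-dec ¬? (edgeIn? F u v)
  ; adj-sym    = λ { (uv , uv∉F) → adj-sym G uv , uv∉F ∘ swap }
  ; adj-irrefl = λ { (vv , _) → adj-irrefl G vv }
  }

Disjoint : ∀ {n} → Pair n → Pair n → Set
Disjoint (a , b) (c , d) = a ≢ c × a ≢ d × b ≢ c × b ≢ d

-- Disjoint edges are distinct, so a matching listed this way has no
-- repetitions and its size is the length of the list.
IsMatching : ∀ {n} → Graph n → List (Pair n) → Set
IsMatching G M = All (uncurry (Adj G)) M × AllPairs Disjoint M

Removable : ∀ {n} → ℕ → Graph n → List (Pair n) → Set
Removable k G M = IsConnected[ k ] (G -ᴱ M)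

HasRemovableMatching : ∀ {n} → ℕ → Graph n → ℕ → Set
HasRemovableMatching {n} k G m =
  Σ[ M ∈ List (Pair n) ] IsMatching G M × length M ≡ m × Removable k G M

AlwaysRemovable : ℕ → ℕ → ℕ → Set₁
AlwaysRemovable k δ m =
  ∀ {n} (G : Graph n) → IsConnected[ k ] G → 2 * δ ≤ n → MinDegree≥ δ G →
  HasRemovableMatching k G m

IsLargest : ∀ {ℓ : Level} → (ℕ → Set ℓ) → ℕ → Set ℓ
IsLargest P m = P m × (∀ m′ → P m′ → m′ ≤ m)

-- f(k,δ) = m.  The function f is represented by its graph; the relation is
-- only meant for δ > k ≥ 1.
f[_,_]≡_ : ℕ → ℕ → ℕ → Set₁
f[ k , δ ]≡ m = IsLargest (AlwaysRemovable k δ) m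

-- A removable matching M of size less than d can be enlarged.  Let H = G - M
-- and call an edge of H critical if H minus that edge is not 2-connected.  If
-- x y is in M, u and v are distinct uncovered vertices, u x is in H, and u y
-- and v x are non-critical, then M - xy + uy + vx is removable, since the path
-- u x y replaces u y.  Were M maximal, counting the edges from two uncovered
-- vertices to M would thus force critical edges at the uncovered vertices.  A
-- critical edge splits H into two sides, and a minimal fragment of a
-- 2-separation inside a side (a free end) has no critical edge at any of its
-- vertices.  A free end contains at least d - 2 covered vertices and M covers
-- at most 2 (d - 1), so, as 3 (d - 2) > 2 (d - 1) for d ≥ 5, there are no three
-- disjoint free ends.  Hence each uncovered vertex has at most one critical
-- edge, and the covered vertices lie, up to few, in two nearly complete ends,
-- where a pair of edges to exchange is found.
-- For the upper bound, the complete graph on 2 d vertices has no matching of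
-- size greater than d.
module Submission where

open import Algebra.Properties.CommutativeSemigroup using (interchange)
open import Data.Empty using (⊥; ⊥-elim)
open import Data.Fin.Base using (Fin)
open import Data.Fin.Properties using (_≟_; any?; all?)
open import Data.Fin.Subset using (∣_∣; ⁅_⁆) renaming (_∈_ to _∈ˢ_)
open import Data.Fin.Subset.Properties
  using (x∈⁅x⁆; x∈⁅y⁆⇒x≡y; ∣⁅x⁆∣≡1; nonempty?; x∈p⇒∣p-x∣<∣p∣; x∈p∧x≢y⇒x∈p-y)
open import Data.List.Base using (List; []; _∷_; length; filter; allFin)
open import Data.List.Membership.Propositional using (_∈_)
import Data.List.Membership.DecPropositional as DecMembership
open import Data.List.Membership.Propositional.Properties using (∈-allFin)
open import Data.List.Properties using (filter-none; length-filter; length-tabulate)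
open import Data.List.Relation.Unary.All as All using (All; []; _∷_)
open import Data.List.Relation.Unary.AllPairs using (AllPairs; []; _∷_; allPairs?)
open import Data.List.Relation.Unary.Any using (here; there)
open import Data.List.Relation.Unary.Unique.Propositional using (Unique)
open import Data.List.Relation.Unary.Unique.Propositional.Properties using (allFin⁺)
open import Data.Nat.Base
open import Data.Nat.Properties hiding (_≟_)
open import Data.Nat.Tactic.RingSolver using (solve-∀)
open import Data.Product.Base using (∃-syntax; _×_; _,_; proj₁; proj₂; uncurry)
open import Data.Sum.Base using (_⊎_; inj₁; inj₂; swap)
open import Function.Base using (_∘_; id; case_of_)
open import Level using (0ℓ)
open import Relation.Binary.Construct.Closure.ReflexiveTransitive as Star using (Star; ε; _◅_; _◅◅_)
open import Relation.Binary.Core using (Rel)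
open import Relation.Binary.Definitions using (Symmetric)
open import Relation.Binary.PropositionalEquality
open import Relation.Nullary.Decidable
  using (Dec; yes; no; _×-dec_; _⊎-dec_; ¬?; _→-dec_; map′; decidable-stable; ¬¬-excluded-middle)
open import Relation.Nullary.Negation using (¬_; contradiction)
open import Relation.Unary using (Pred; Decidable; _⊆_; _∪_; _∩_; ∁; U)
open import Relation.Unary.Properties using (_∩?_; ∁?; U?)
open import Defs

-- Counting the elements of decidable predicates

count : ∀ {A : Set} {P : Pred A 0ℓ} → Decidable P → List A → ℕ
count P? xs = length (filter P? xs)

module _ {A : Set} {P Q : Pred A 0ℓ} (P? : Decidable P) (Q? : Decidable Q) where

  count-mono : ∀ xs → (∀ {x} → x ∈ xs → P x → Q x) → count P? xs ≤ count Q? xs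
  count-mono []       P⊆Q = z≤n
  count-mono (x ∷ xs) P⊆Q with P? x | Q? x
  ... | yes p | yes q = s≤s (count-mono xs (P⊆Q ∘ there))
  ... | yes p | no ¬q = contradiction (P⊆Q (here refl) p) ¬q
  ... | no ¬p | yes q = m≤n⇒m≤1+n (count-mono xs (P⊆Q ∘ there))
  ... | no ¬p | no ¬q = count-mono xs (P⊆Q ∘ there)

module _ {A : Set} {P Q R : Pred A 0ℓ}
         (P? : Decidable P) (Q? : Decidable Q) (R? : Decidable R) where

  count-∪ : ∀ xs → P ⊆ Q ∪ R → count P? xs ≤ count Q? xs + count R? xs
  count-∪ []       P⊆Q∪R = z≤n
  count-∪ (x ∷ xs) P⊆Q∪R with P? x | Q? x | R? x | count-∪ xs P⊆Q∪R
  ... | yes p | yes _ | yes _ | ih = s≤s (≤-trans ih (+-monoʳ-≤ (count Q? xs) (n≤1+n _)))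
  ... | yes p | yes _ | no _  | ih = s≤s ih
  ... | yes p | no _  | yes _ | ih = ≤-trans (s≤s ih) (≤-reflexive (sym (+-suc _ _)))
  ... | yes p | no ¬q | no ¬r | ih with P⊆Q∪R p
  ...   | inj₁ q = contradiction q ¬q
  ...   | inj₂ r = contradiction r ¬r
  count-∪ (x ∷ xs) P⊆Q∪R | no _ | yes _ | yes _ | ih = m≤n⇒m≤1+n (≤-trans ih (+-monoʳ-≤ (count Q? xs) (n≤1+n _)))
  count-∪ (x ∷ xs) P⊆Q∪R | no _ | yes _ | no _  | ih = m≤n⇒m≤1+n ih
  count-∪ (x ∷ xs) P⊆Q∪R | no _ | no _  | yes _ | ih = ≤-trans ih (+-monoʳ-≤ (count Q? xs) (n≤1+n _))
  count-∪ (x ∷ xs) P⊆Q∪R | no _ | no _  | no _  | ih = ih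

  count-⊎ : ∀ xs → Q ⊆ P → R ⊆ P → (∀ {x} → Q x → R x → ⊥) →
            count Q? xs + count R? xs ≤ count P? xs
  count-⊎ []       _ _ _ = z≤n
  count-⊎ (x ∷ xs) Q⊆P R⊆P Q⊥R with P? x | Q? x | R? x | count-⊎ xs Q⊆P R⊆P Q⊥R
  ... | _     | yes q | yes r | ih = ⊥-elim (Q⊥R q r)
  ... | yes p | yes q | no _  | ih = s≤s ih
  ... | yes p | no _  | yes r | ih = ≤-trans (≤-reflexive (+-suc _ _)) (s≤s ih)
  ... | yes p | no _  | no _  | ih = m≤n⇒m≤1+n ih
  ... | no ¬p | yes q | no _  | ih = contradiction (Q⊆P q) ¬p
  ... | no ¬p | no _  | yes r | ih = contradiction (R⊆P r) ¬p
  ... | no ¬p | no _  | no _  | ih = ih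

module _ {n : ℕ} where

  # : {P : Pred (Fin n) 0ℓ} → Decidable P → ℕ
  # P? = count P? (allFin n)

  private variable P Q R : Pred (Fin n) 0ℓ

  #-mono : (P? : Decidable P) (Q? : Decidable Q) → P ⊆ Q → # P? ≤ # Q?
  #-mono P? Q? P⊆Q = count-mono P? Q? (allFin n) (λ _ → P⊆Q)

  #-∪ : (P? : Decidable P) (Q? : Decidable Q) (R? : Decidable R) → P ⊆ Q ∪ R → # P? ≤ # Q? + # R?
  #-∪ P? Q? R? = count-∪ P? Q? R? (allFin n)

  #-⊎ : (P? : Decidable P) (Q? : Decidable Q) (R? : Decidable R) → Q ⊆ P → R ⊆ P →
        (∀ {x} → Q x → R x → ⊥) → # Q? + # R? ≤ # P?
  #-⊎ P? Q? R? = count-⊎ P? Q? R? (allFin n)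

  count-all : (xs : List (Fin n)) → count U? xs ≡ length xs
  count-all []       = refl
  count-all (x ∷ xs) = cong suc (count-all xs)

  #-U : # {P = U} U? ≡ n
  #-U = trans (count-all (allFin n)) (length-tabulate id)

  #-｛｝ : ∀ x → # (x ≟_) ≤ 1
  #-｛｝ x = atMostOne (allFin n) (allFin⁺ n)
    where
    atMostOne : ∀ xs → Unique xs → count (x ≟_) xs ≤ 1
    atMostOne []       _           = z≤n
    atMostOne (y ∷ xs) (y∉xs ∷ xs!) with x ≟ y
    ... | yes refl = s≤s (≤-reflexive (cong length (filter-none (x ≟_) y∉xs)))
    ... | no _     = atMostOne xs xs!

  #-pos : (P? : Decidable P) → ∀ {x} → P x → 1 ≤ # P?
  #-pos {P = P} P? {x} px = pos (allFin n) (∈-allFin x)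
    where
    pos : ∀ xs → x ∈ xs → 1 ≤ count P? xs
    pos (y ∷ xs) x∈ with P? y
    pos (y ∷ xs) x∈         | yes _  = s≤s z≤n
    pos (y ∷ xs) (here refl) | no ¬py = contradiction px ¬py
    pos (y ∷ xs) (there x∈)  | no _   = pos xs x∈

  #-insert : (P? : Decidable P) (Q? : Decidable Q) → ∀ x → P ⊆ Q → Q x → ¬ P x → suc (# P?) ≤ # Q?
  #-insert P? Q? x P⊆Q qx ¬px = ≤-trans (+-monoˡ-≤ (# P?) (#-pos (x ≟_) refl))
    (#-⊎ Q? (x ≟_) P? (λ { refl → qx }) P⊆Q (λ { refl px → ¬px px }))

  #-delete : (P? : Decidable P) (Q? : Decidable Q) → ∀ x → (∀ {y} → P y → x ≢ y → Q y) → # P? ≤ suc (# Q?)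
  #-delete P? Q? x P∖x⊆Q = ≤-trans (#-∪ P? (x ≟_) Q? split) (+-monoˡ-≤ (# Q?) (#-｛｝ x))
    where
    split : ∀ {y} → _ → (x ≡ y) ⊎ _
    split {y} py with x ≟ y
    ... | yes x≡y = inj₁ x≡y
    ... | no  x≢y = inj₂ (P∖x⊆Q py x≢y)

  #-exceeds : (P? : Decidable P) (Q? : Decidable Q) → # Q? < # P? → ∃[ x ] P x × ¬ Q x
  #-exceeds P? Q? Q<P with any? (P? ∩? ∁? Q?)
  ... | yes x = x
  ... | no ∄x = contradiction (#-mono P? Q? P⊆Q) (<⇒≱ Q<P)
    where
    P⊆Q : ∀ {x} → _ → _
    P⊆Q {x} px with Q? x
    ... | yes qx = qx
    ... | no ¬qx = contradiction (x , px , ¬qx) ∄x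

  #-∅ : (P? : Decidable P) → (∀ {x} → ¬ P x) → # P? ≡ 0
  #-∅ P? ∅ = cong length (filter-none P? (All.universal (λ _ → ∅) (allFin n)))

  #≤count : (P? : Decidable P) → ∀ xs → (∀ {x} → P x → x ∈ xs) → # P? ≤ count P? xs
  #≤count P? [] P⊆[] = ≤-reflexive (#-∅ P? (λ px → case P⊆[] px of λ ()))
  #≤count {P = P} P? (y ∷ xs) P⊆ = step
    where
    P∖y? : Decidable (P ∩ (λ x → y ≢ x))
    P∖y? x = P? x ×-dec ¬? (y ≟ x)
    P∖y⊆ : ∀ {x} → P x × y ≢ x → x ∈ xs
    P∖y⊆ (px , y≢x) with P⊆ px
    ... | here x≡y = contradiction (sym x≡y) y≢x
    ... | there x∈ = x∈
    ih : # P∖y? ≤ count P? xs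
    ih = ≤-trans (#≤count P∖y? xs P∖y⊆) (count-mono P∖y? P? xs (λ _ → proj₁))
    step : # P? ≤ count P? (y ∷ xs)
    step with P? y
    ... | yes _  = ≤-trans (#-delete P? P∖y? y _,_) (s≤s ih)
    ... | no ¬py = ≤-trans (#-mono P? P∖y? (λ px → px , λ { refl → ¬py px })) ih

  count≤# : (P? : Decidable P) → ∀ {xs} → Unique xs → count P? xs ≤ # P?
  count≤# P? []  = z≤n
  count≤# {P = P} P? {y ∷ xs} (y∉xs ∷ xs!) = step
    where
    P∖y? : Decidable (P ∩ (λ x → y ≢ x))
    P∖y? x = P? x ×-dec ¬? (y ≟ x)
    ih : count P? xs ≤ # P∖y?
    ih = ≤-trans (count-mono P? P∖y? xs (λ x∈ px → px , All.lookup y∉xs x∈)) (count≤# P∖y? xs!)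
    step : count P? (y ∷ xs) ≤ # P?
    step with P? y
    ... | yes py = ≤-trans (s≤s ih) (#-insert P∖y? P? y proj₁ py (λ q → proj₂ q refl))
    ... | no _   = ≤-trans ih (#-mono P∖y? P? proj₁)

-- 2-connected relations, critical edges and edge exchanges

module _ {n : ℕ} where

  private V = Fin n

  NoCross : Rel V 0ℓ → V → Pred V 0ℓ → Set
  NoCross E z P = ∀ {s t} → P s → ¬ P t → s ≢ z → t ≢ z → ¬ E s t

  -- 2-connectedness by cuts instead of paths; it is a negative statement, hence
  -- stable under double negation.
  TwoConn : Rel V 0ℓ → Set₁
  TwoConn E = ∀ z {P} → Decidable P → ∀ {a b} → P a → ¬ P b → a ≢ z → b ≢ z → ¬ NoCross E z P

  _∖⟨_,_⟩ : Rel V 0ℓ → V → V → Rel V 0ℓ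
  (E ∖⟨ u , b ⟩) s t = E s t × ¬ (s ≡ u × t ≡ b) × ¬ (s ≡ b × t ≡ u)

  NonCritical : Rel V 0ℓ → V → V → Set₁
  NonCritical E u b = TwoConn (E ∖⟨ u , b ⟩)

  NonCritical-stable : ∀ {E u b} → ¬ ¬ NonCritical E u b → NonCritical E u b
  NonCritical-stable ¬¬nc z P? Pa ¬Pb a≢z b≢z nx = ¬¬nc λ nc → nc z P? Pa ¬Pb a≢z b≢z nx

  TwoConn-mono : ∀ {E F} → (∀ {s t} → E s t → F s t) → TwoConn E → TwoConn F
  TwoConn-mono E⊆F tc z P? Pa ¬Pb a≢z b≢z nx =
    tc z P? Pa ¬Pb a≢z b≢z λ Ps ¬Pt s≢z t≢z Est → nx Ps ¬Pt s≢z t≢z (E⊆F Est)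

  NonCritical-sym : ∀ {E u b} → NonCritical E u b → NonCritical E b u
  NonCritical-sym = TwoConn-mono λ (e , f , g) → e , g , f

  -- X is a union of components of E - {p, q}, and not everything there.
  record End (E : Rel V 0ℓ) (X : Pred V 0ℓ) (p q : V) : Set where
    field
      X?      : Decidable X
      inner   : V
      inner∈  : X inner
      p∉      : ¬ X p
      q∉      : ¬ X q
      closed  : ∀ {s t} → X s → E s t → X t ⊎ t ≡ p ⊎ t ≡ q
      outer   : V
      outer∉  : ¬ X outer
      outer≢p : outer ≢ p
      outer≢q : outer ≢ q

  -- A witness that deleting the edge x y leaves z as a cut vertex, A being
  -- the side of x.
  record CritCut (E : Rel V 0ℓ) (x y z : V) (A : Pred V 0ℓ) : Set where
    field
      A?   : Decidable A
      x∈   : A x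
      y∉   : ¬ A y
      x≢z  : x ≢ z
      y≢z  : y ≢ z
      only : ∀ {s t} → A s → ¬ A t → s ≢ z → t ≢ z → E s t → s ≡ x × t ≡ y

  Free : Rel V 0ℓ → Pred V 0ℓ → Set₁
  Free E X = ∀ {x y} → X x → E x y → NonCritical E x y

  module TwoConnected
    {E : Rel V 0ℓ} (E-sym : Symmetric E) (E-irrefl : ∀ {v} → ¬ E v v) (tc : TwoConn E)
    where

    -- If `p` and `q` coincided, that single vertex would separate `inner` from `outer`.
    End-≢ : ∀ {X p q} → End E X p q → p ≢ q
    End-≢ {X} {p} e refl = tc p X? inner∈ outer∉ (λ { refl → p∉ inner∈ }) outer≢p
      λ Xs ¬Xt s≢p t≢p Est → case closed Xs Est of λ where
        (inj₁ Xt) → ¬Xt Xt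
        (inj₂ (inj₁ t≡p)) → t≢p t≡p
        (inj₂ (inj₂ t≡p)) → t≢p t≡p
      where open End e

    End-∁ : ∀ {S p q} → End E S p q → End E (λ v → ¬ S v × v ≢ p × v ≢ q) p q
    End-∁ {S} {p} {q} e = record
      { X? = λ v → ¬? (X? v) ×-dec ¬? (v ≟ p) ×-dec ¬? (v ≟ q)
      ; inner = outer ; inner∈ = outer∉ , outer≢p , outer≢q
      ; p∉ = λ (_ , p≢p , _) → p≢p refl
      ; q∉ = λ (_ , _ , q≢q) → q≢q refl
      ; closed = cl
      ; outer = inner ; outer∉ = λ (¬Si , _) → ¬Si inner∈
      ; outer≢p = λ { refl → p∉ inner∈ } ; outer≢q = λ { refl → q∉ inner∈ }
      }
      where
      open End e
      cl : ∀ {s t} → ¬ S s × s ≢ p × s ≢ q → E s t → (¬ S t × t ≢ p × t ≢ q) ⊎ t ≡ p ⊎ t ≡ q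
      cl {s} {t} (¬Ss , s≢p , s≢q) Est with t ≟ p | t ≟ q
      ... | yes t≡p | _ = inj₂ (inj₁ t≡p)
      ... | no _ | yes t≡q = inj₂ (inj₂ t≡q)
      ... | no t≢p | no t≢q = inj₁ (¬St , t≢p , t≢q)
        where
        ¬St : ¬ S t
        ¬St St with closed St (E-sym Est)
        ... | inj₁ Ss = ¬Ss Ss
        ... | inj₂ (inj₁ s≡p) = s≢p s≡p
        ... | inj₂ (inj₂ s≡q) = s≢q s≡q

    End-swap : ∀ {S p q} → End E S p q → End E S q p
    End-swap e = record
      { X? = X? ; inner = inner ; inner∈ = inner∈ ; p∉ = q∉ ; q∉ = p∉
      ; closed = λ Xs Est → case closed Xs Est of λ where
          (inj₁ Xt) → inj₁ Xt
          (inj₂ (inj₁ t≡p)) → inj₂ (inj₂ t≡p)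
          (inj₂ (inj₂ t≡q)) → inj₂ (inj₁ t≡q)
      ; outer = outer ; outer∉ = outer∉ ; outer≢p = outer≢q ; outer≢q = outer≢p }
      where open End e

    CritCut-swap : ∀ {x y z A} → CritCut E x y z A → CritCut E y x z (∁ A)
    CritCut-swap c = record
      { A? = ∁? A? ; x∈ = y∉ ; y∉ = λ ¬Ax → ¬Ax x∈ ; x≢z = y≢z ; y≢z = x≢z
      ; only = λ {s} {t} ¬As ¬¬At s≢z t≢z Est →
          let t≡x , s≡y = only (decidable-stable (A? t) ¬¬At) ¬As t≢z s≢z (E-sym Est)
          in s≡y , t≡x }
      where open CritCut c

    -- A cut of `E` without the edge x y is already a cut of `E` unless that edge crosses it. The
    -- continuation form is due to `NonCritical` being negative: its failure yields a cut only up to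
    -- double negation.
    critCut : ∀ {x y} → ¬ NonCritical E x y → (∀ {z A} → CritCut E x y z A → ⊥) → ⊥
    critCut {x} {y} ¬nc k = ¬nc main
      where
      main : NonCritical E x y
      main z {P} P? {a} {b} Pa ¬Pb a≢z b≢z nx = go (P? x) (P? y) (x ≟ z) (y ≟ z)
        where
        harmless : (∀ {s t} → P s → ¬ P t → s ≢ z → t ≢ z → ¬ (s ≡ x × t ≡ y) × ¬ (s ≡ y × t ≡ x)) → ⊥
        harmless h = tc z P? Pa ¬Pb a≢z b≢z λ Ps ¬Pt s≢z t≢z Est →
          nx Ps ¬Pt s≢z t≢z (Est , h Ps ¬Pt s≢z t≢z)
        crosses : ∀ {x y} → P x → ¬ P y → x ≢ z → y ≢ z →
                  (∀ {s t} → P s → ¬ P t → s ≢ z → t ≢ z → E s t → ¬ (s ≡ x × t ≡ y) → ⊥) → CritCut E x y z P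
        crosses {x} {y} Px ¬Py x≢z y≢z nx′ = record
          { A? = P? ; x∈ = Px ; y∉ = ¬Py ; x≢z = x≢z ; y≢z = y≢z
          ; only = λ {s} {t} Ps ¬Pt s≢z t≢z Est →
              decidable-stable (s ≟ x ×-dec t ≟ y) (nx′ Ps ¬Pt s≢z t≢z Est) }
        go : Dec (P x) → Dec (P y) → Dec (x ≡ z) → Dec (y ≡ z) → ⊥
        go _ _ (yes refl) _ = harmless λ _ _ s≢z t≢z → (λ (s≡z , _) → s≢z s≡z) , (λ (_ , t≡z) → t≢z t≡z)
        go _ _ _ (yes refl) = harmless λ _ _ s≢z t≢z → (λ (_ , t≡z) → t≢z t≡z) , (λ (s≡z , _) → s≢z s≡z)
        go (yes Px) (yes Py) _ _ = harmless λ _ ¬Pt _ _ → (λ { (_ , refl) → ¬Pt Py }) , (λ { (_ , refl) → ¬Pt Px })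
        go (no ¬Px) (no ¬Py) _ _ = harmless λ Ps _ _ _ → (λ { (refl , _) → ¬Px Ps }) , (λ { (refl , _) → ¬Py Ps })
        go (yes Px) (no ¬Py) (no x≢z) (no y≢z) = k (crosses Px ¬Py x≢z y≢z
          λ Ps ¬Pt s≢z t≢z Est ≢xy → nx Ps ¬Pt s≢z t≢z (Est , ≢xy , λ { (refl , _) → ¬Py Ps }))
        go (no ¬Px) (yes Py) (no x≢z) (no y≢z) = k (CritCut-swap (crosses Py ¬Px y≢z x≢z
          λ Ps ¬Pt s≢z t≢z Est ≢yx → nx Ps ¬Pt s≢z t≢z (Est , (λ { (refl , _) → ¬Px Ps }) , ≢yx)))

    -- The path u x y in E′ makes the deletion of u y harmless, except after
    -- deleting a vertex of that path, when at most one deleted edge remains.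
    exchange : ∀ {u v x y} {E′ : Rel V 0ℓ} → Symmetric E′ →
      (∀ {s t} → ((E ∖⟨ u , y ⟩) ∖⟨ v , x ⟩) s t → E′ s t) → E′ x y →
      u ≢ v → x ≢ y → E u x → NonCritical E u y → NonCritical E v x → TwoConn E′
    exchange {u} {v} {x} {y} {E′} E′-sym sub xy u≢v x≢y ux nc-uy nc-vx z {P} P? {a} {b} Pa ¬Pb a≢z b≢z nx =
      go (z ≟ u) (z ≟ v) (z ≟ x) (z ≟ y)
      where
      u≢x : u ≢ x
      u≢x refl = E-irrefl ux
      ux′ : E′ u x
      ux′ = sub ((ux , (λ (_ , x≡y) → x≢y x≡y) , (λ (u≡y , x≡u) → u≢x (sym x≡u))) ,
                 (λ (u≡v , _) → u≢v u≡v) , (λ (u≡x , _) → u≢x u≡x))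
      via-vx : (∀ {s t} → P s → ¬ P t → s ≢ z → t ≢ z → ¬ (s ≡ u × t ≡ y) × ¬ (s ≡ y × t ≡ u)) → ⊥
      via-vx h = nc-vx z P? Pa ¬Pb a≢z b≢z λ Ps ¬Pt s≢z t≢z (e , f) →
        nx Ps ¬Pt s≢z t≢z (sub ((e , h Ps ¬Pt s≢z t≢z) , f))
      via-uy : (∀ {s t} → P s → ¬ P t → s ≢ z → t ≢ z → ¬ (s ≡ v × t ≡ x) × ¬ (s ≡ x × t ≡ v)) → ⊥
      via-uy h = nc-uy z P? Pa ¬Pb a≢z b≢z λ Ps ¬Pt s≢z t≢z e → nx Ps ¬Pt s≢z t≢z (sub (e , h Ps ¬Pt s≢z t≢z))
      same : ∀ {s t} → s ≢ z → t ≢ z → E′ s t → P s → P t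
      same {s} {t} s≢z t≢z e Ps = decidable-stable (P? t) λ ¬Pt → nx Ps ¬Pt s≢z t≢z e
      go : Dec (z ≡ u) → Dec (z ≡ v) → Dec (z ≡ x) → Dec (z ≡ y) → ⊥
      go (yes refl) _ _ _ = via-vx λ _ _ s≢z t≢z → (λ (e , _) → s≢z e) , (λ (_ , e) → t≢z e)
      go _ _ _ (yes refl) = via-vx λ _ _ s≢z t≢z → (λ (_ , e) → t≢z e) , (λ (e , _) → s≢z e)
      go _ (yes refl) _ _ = via-uy λ _ _ s≢z t≢z → (λ (e , _) → s≢z e) , (λ (_ , e) → t≢z e)
      go _ _ (yes refl) _ = via-uy λ _ _ s≢z t≢z → (λ (_ , e) → t≢z e) , (λ (e , _) → s≢z e)
      go (no z≢u) _ (no z≢x) (no z≢y) = via-vx λ Ps ¬Pt _ _ →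
        (λ { (refl , refl) → ¬Pt (same (z≢x ∘ sym) (z≢y ∘ sym) xy (same (z≢u ∘ sym) (z≢x ∘ sym) ux′ Ps)) }) ,
        (λ { (refl , refl) → ¬Pt (same (z≢x ∘ sym) (z≢u ∘ sym) (E′-sym ux′)
           (same (z≢y ∘ sym) (z≢x ∘ sym) (E′-sym xy) Ps)) })

    -- The variant for x and y on opposite sides of the critical edge u b, where u y need not be
    -- present. A cut of `E′` that is not already one after deleting just one of the two edges keeps
    -- x and y together and separates them from u; only such cuts need the critical edge.
    crossExchange : ∀ {u b w A v x y} {E′ : Rel V 0ℓ} → Symmetric E′ →
      (∀ {s t} → ((E ∖⟨ u , x ⟩) ∖⟨ v , y ⟩) s t → E′ s t) → E′ x y →
      u ≢ v → E u b → CritCut E u b w A → A x → ¬ A y → x ≢ w → y ≢ w →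
      E u x → NonCritical E u x → NonCritical E v y → TwoConn E′
    crossExchange {u} {b} {w} {A} {v} {x} {y} {E′} E′-sym sub xy u≢v ub cut Ax ¬Ay x≢w y≢w ux nc-ux nc-vy
      z {P} P? {c} {d} Pc ¬Pd c≢z d≢z nx = go (z ≟ u) (z ≟ v) (z ≟ x) (z ≟ y)
      where
      open CritCut cut
      u≢x : u ≢ x
      u≢x refl = E-irrefl ux
      via-vy : (∀ {s t} → P s → ¬ P t → s ≢ z → t ≢ z → ¬ (s ≡ u × t ≡ x) × ¬ (s ≡ x × t ≡ u)) → ⊥
      via-vy h = nc-vy z P? Pc ¬Pd c≢z d≢z λ Ps ¬Pt s≢z t≢z (e , f) →
        nx Ps ¬Pt s≢z t≢z (sub ((e , h Ps ¬Pt s≢z t≢z) , f))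
      via-ux : (∀ {s t} → P s → ¬ P t → s ≢ z → t ≢ z → ¬ (s ≡ v × t ≡ y) × ¬ (s ≡ y × t ≡ v)) → ⊥
      via-ux h = nc-ux z P? Pc ¬Pd c≢z d≢z λ Ps ¬Pt s≢z t≢z e → nx Ps ¬Pt s≢z t≢z (sub (e , h Ps ¬Pt s≢z t≢z))

      Separated : Set₁
      Separated = ∀ {D} → Decidable D → D x → D y → ¬ D u → z ≢ u →
                  (∀ {s t} → D s → ¬ D t → s ≢ z → t ≢ z → ¬ E′ s t) → ⊥

      -- A cut of E′ - z separating x and y from u would have to put w, if z
      -- lies beyond u b, or b, otherwise, on both of its sides.
      near : ¬ A z → z ≢ w → Separated
      near ¬Az z≢w {D} D? Dx Dy ¬Du z≢u nx′ =
        nc-ux b C∩A? (¬Du , x∈ , x≢z) (λ (_ , _ , w≢w) → w≢w refl)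
          (λ { refl → y∉ x∈ }) (y≢z ∘ sym) cross₂
        where
        keep : ∀ {s t} → A s → s ≢ w → A t ⊎ t ≡ w → E s t → ¬ (s ≡ u × t ≡ x) → ¬ (s ≡ x × t ≡ u) → E′ s t
        keep As s≢w t∈ e f g = sub ((e , f , g) ,
          (λ { (refl , refl) → case t∈ of λ { (inj₁ Ay) → ¬Ay Ay ; (inj₂ y≡w) → y≢w y≡w } }) ,
          (λ { (refl , refl) → ¬Ay As }))
        off-z : ∀ {t} → A t ⊎ t ≡ w → t ≢ z
        off-z (inj₁ At) refl = ¬Az At
        off-z (inj₂ refl) w≡z = z≢w (sym w≡z)
        D∩A? : Decidable (λ s → D s × A s × s ≢ w)
        D∩A? s = D? s ×-dec A? s ×-dec ¬? (s ≟ w)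
        C∩A? : Decidable (λ s → ¬ D s × A s × s ≢ w)
        C∩A? s = ¬? (D? s) ×-dec A? s ×-dec ¬? (s ≟ w)
        side : ∀ {s t} → A s → s ≢ w → E s t → ¬ (s ≡ u × t ≡ b) → A t ⊎ t ≡ w
        side {s} {t} As s≢w e ≢ub with A? t | t ≟ w
        ... | yes At | _ = inj₁ At
        ... | no _ | yes t≡w = inj₂ t≡w
        ... | no ¬At | no t≢w = contradiction (only As ¬At s≢w t≢w e) ≢ub
        -- Otherwise u alone would separate the part of `D` in `A` from w.
        Dw : D w
        Dw = decidable-stable (D? w) λ ¬Dw →
          tc u D∩A? (Dx , Ax , x≢w) (λ (_ , _ , w≢w) → w≢w refl) (λ { refl → ¬Du Dx }) (x≢z ∘ sym)
            λ {s} {t} (Ds , As , s≢w) t∉ s≢u t≢u e →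
              let t∈ = side As s≢w e (λ (s≡u , _) → s≢u s≡u)
                  ¬Dt : ¬ D t
                  ¬Dt Dt = case t∈ of λ where
                    (inj₁ At) → t∉ (Dt , At , λ { refl → ¬Dw Dt })
                    (inj₂ refl) → ¬Dw Dt
              in nx′ Ds ¬Dt (off-z (inj₁ As)) (off-z t∈)
                   (keep As s≢w t∈ e (λ (s≡u , _) → s≢u s≡u) (λ (_ , t≡u) → t≢u t≡u))
        -- Now b separates the part of `A` outside `D`, which contains u, from w once u x is
        -- deleted.
        cross₂ : NoCross (E ∖⟨ u , x ⟩) b (λ s → ¬ D s × A s × s ≢ w)
        cross₂ {s} {t} (¬Ds , As , s≢w) t∉ s≢b t≢b (e , f , g) =
              let t∈ = side As s≢w e (λ (_ , t≡b) → t≢b t≡b)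
                  Dt : D t
                  Dt = decidable-stable (D? t) λ ¬Dt → case t∈ of λ where
                    (inj₁ At) → t∉ (¬Dt , At , λ { refl → ¬Dt Dw })
                    (inj₂ refl) → ¬Dt Dw
              in nx′ Dt ¬Ds (off-z t∈) (off-z (inj₁ As)) (E′-sym (keep As s≢w t∈ e f g))
      beyond : A z ⊎ z ≡ w → Separated
      beyond z∈ {D} D? Dx Dy ¬Du z≢u nx′ = nx′ Db ¬Du b≢z (z≢u ∘ sym) (E′-sym (sub
        ((ub , (λ { (_ , refl) → y∉ Ax }) , (λ { (refl , _) → E-irrefl ux })) ,
         (λ (u≡v , _) → u≢v u≡v) , (λ { (refl , _) → ¬Ay x∈ }))))
        where
        off-z : ∀ {t} → ¬ A t → t ≢ w → t ≢ z
        off-z ¬At t≢w refl = case z∈ of λ { (inj₁ Az) → ¬At Az ; (inj₂ z≡w) → t≢w z≡w }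
        b≢z : b ≢ z
        b≢z = off-z y∉ y≢z
        D∖A? : Decidable (λ s → D s × ¬ A s × s ≢ w)
        D∖A? s = D? s ×-dec ¬? (A? s) ×-dec ¬? (s ≟ w)
        -- Otherwise w alone would separate the part of `D` outside `A` from u once v y is deleted.
        Db : D b
        Db = decidable-stable (D? b) λ ¬Db →
          nc-vy w D∖A? (Dy , ¬Ay , y≢w) (λ (_ , ¬Au , _) → ¬Au x∈) y≢w x≢z
            λ {s} {t} (Ds , ¬As , s≢w) t∉ s≢w t≢w (e , f) → case A? t of λ where
              (yes At) → case only At ¬As t≢w s≢w (E-sym e) of λ { (_ , refl) → ¬Db Ds }
              (no ¬At) → nx′ Ds (λ Dt → t∉ (Dt , ¬At , t≢w)) (off-z ¬As s≢w) (off-z ¬At t≢w)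
                (sub ((e , (λ { (refl , _) → ¬As x∈ }) , (λ { (refl , _) → ¬As Ax })) , f))

      separated : Separated
      separated with A? z | z ≟ w
      ... | yes Az | _       = beyond (inj₁ Az)
      ... | no _   | yes z≡w = beyond (inj₂ z≡w)
      ... | no ¬Az | no z≢w  = near ¬Az z≢w

      go : Dec (z ≡ u) → Dec (z ≡ v) → Dec (z ≡ x) → Dec (z ≡ y) → ⊥
      go (yes refl) _ _ _ = via-vy λ _ _ s≢z t≢z → (λ (e , _) → s≢z e) , (λ (_ , e) → t≢z e)
      go _ _ (yes refl) _ = via-vy λ _ _ s≢z t≢z → (λ (_ , e) → t≢z e) , (λ (e , _) → s≢z e)
      go _ (yes refl) _ _ = via-ux λ _ _ s≢z t≢z → (λ (e , _) → s≢z e) , (λ (_ , e) → t≢z e)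
      go _ _ _ (yes refl) = via-ux λ _ _ s≢z t≢z → (λ (_ , e) → t≢z e) , (λ (e , _) → s≢z e)
      go (no z≢u) (no z≢v) (no z≢x) (no z≢y) with P? x | P? y | P? u
      ... | yes Px | no ¬Py | _ = nx Px ¬Py (z≢x ∘ sym) (z≢y ∘ sym) xy
      ... | no ¬Px | yes Py | _ = nx Py ¬Px (z≢y ∘ sym) (z≢x ∘ sym) (E′-sym xy)
      ... | yes Px | yes Py | yes Pu = via-vy λ _ ¬Pt _ _ → (λ { (_ , refl) → ¬Pt Px }) , (λ { (_ , refl) → ¬Pt Pu })
      ... | no ¬Px | no ¬Py | no ¬Pu = via-vy λ Ps _ _ _ → (λ { (refl , _) → ¬Pu Ps }) , (λ { (refl , _) → ¬Px Ps })
      ... | yes Px | yes Py | no ¬Pu = separated P? Px Py ¬Pu z≢u nx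
      ... | no ¬Px | no ¬Py | yes Pu = separated (∁? P?) ¬Px ¬Py (λ ¬Pu → ¬Pu Pu) z≢u
              λ {s} {t} ¬Ps ¬¬Pt s≢z t≢z e → nx (decidable-stable (P? t) ¬¬Pt) ¬Ps t≢z s≢z (E′-sym e)

-- Shrinking ends to free ends

module Ends
  {n : ℕ} {E : Rel (Fin n) 0ℓ} (E-sym : Symmetric E) (E-irrefl : ∀ {v} → ¬ E v v) (tc : TwoConn E)
  (deg≥3 : ∀ c p q → ∃[ t ] E c t × t ≢ p × t ≢ q)
  where

  open TwoConnected E-sym E-irrefl tc

  private
    V = Fin n

    -- The continuation that consumes a smaller end, where `c` will be a vertex of `X`.
    Smaller : Pred V 0ℓ → V → Set₁
    Smaller X c = ∀ {Y r s} → End E Y r s → Y ⊆ X → ¬ Y c → ⊥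

  -- Off `z`, the side `A` can be left only from `x`, so removing `x` closes it up. It does not
  -- become empty: `x` has a neighbour other than `y` and `z`, which must lie in `A`.
  cutEnd : ∀ {x y z A} → CritCut E x y z A → E x y → End E (λ s → A s × s ≢ x × s ≢ z) x z
  cutEnd {x} {y} {z} {A} cut xy with deg≥3 x y z
  ... | t , xt , t≢y , t≢z = record
    { X? = λ s → A? s ×-dec ¬? (s ≟ x) ×-dec ¬? (s ≟ z)
    ; inner = t
    ; inner∈ = decidable-stable (A? t) (λ ¬At → t≢y (proj₂ (only x∈ ¬At x≢z t≢z xt)))
             , (λ { refl → E-irrefl xt }) , t≢z
    ; p∉ = λ (_ , x≢x , _) → x≢x refl
    ; q∉ = λ (_ , _ , z≢z) → z≢z refl
    ; closed = cl
    ; outer = y ; outer∉ = y∉ ∘ proj₁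
    ; outer≢p = λ { refl → E-irrefl xy } ; outer≢q = y≢z }
    where
    open CritCut cut
    cl : ∀ {s t} → A s × s ≢ x × s ≢ z → E s t → (A t × t ≢ x × t ≢ z) ⊎ t ≡ x ⊎ t ≡ z
    cl {s} {t} (As , s≢x , s≢z) e with t ≟ x | t ≟ z | A? t
    ... | yes t≡x | _ | _ = inj₂ (inj₁ t≡x)
    ... | no _ | yes t≡z | _ = inj₂ (inj₂ t≡z)
    ... | no t≢x | no t≢z | yes At = inj₁ (At , t≢x , t≢z)
    ... | no t≢x | no t≢z | no ¬At = contradiction (proj₁ (only As ¬At s≢z t≢z e)) s≢x

  module _ {X p q} (end : End E X p q) {c} (Xc : X c) where
    open End end

    X-closed : ∀ {s t} → X s → E s t → t ≢ p → t ≢ q → X t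
    X-closed Xs e t≢p t≢q with closed Xs e
    ... | inj₁ Xt = Xt
    ... | inj₂ (inj₁ t≡p) = contradiction t≡p t≢p
    ... | inj₂ (inj₂ t≡q) = contradiction t≡q t≢q

    ≢X : ∀ {s t} → ¬ X s → X t → s ≢ t
    ≢X ¬Xs Xt refl = ¬Xs Xt

    -- `R` lies inside `X`: as `p` and `q` are not in `R`, no edge joins the part of `R` outside `X`
    -- to `X`, and `z` alone would cut that part off.
    shrink₁ : ∀ {R z} → End E R c z → ¬ R p → ¬ R q → Smaller X c → ⊥
    shrink₁ {R} {z} endR ¬Rp ¬Rq k = k endR R⊆X R.p∉
      where
      module R = End endR
      R⊆X : R ⊆ X
      R⊆X {r} Rr = decidable-stable (X? r) λ ¬Xr →
        tc z (λ s → R.X? s ×-dec ¬? (X? s)) (Rr , ¬Xr) (λ (_ , ¬Xc) → ¬Xc Xc)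
          (λ { refl → R.q∉ Rr }) (End-≢ endR) λ {s} {t} (Rs , ¬Xs) t∉ _ t≢z e →
            let ¬Xt : ¬ X t
                ¬Xt Xt = ¬Xs (X-closed Xt (E-sym e) (λ { refl → ¬Rp Rs }) (λ { refl → ¬Rq Rs }))
            in case R.closed Rs e of λ where
                 (inj₁ Rt) → t∉ (Rt , ¬Xt)
                 (inj₂ (inj₁ refl)) → ¬Xt Xc
                 (inj₂ (inj₂ t≡z)) → t≢z t≡z

    -- As `c` and `z` lie in `X`, the vertices of `R` outside `X` other than `p` can be left only
    -- through `p`, which would be a cut vertex.
    half-outside : ∀ {R z} → End E R c z → X z → R p → ¬ R q → ∀ {o} → R o → ¬ X o → o ≢ p → ⊥
    half-outside {R} {z} endR Xz Rp ¬Rq {o} Ro ¬Xo o≢p =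
      tc p (λ s → R.X? s ×-dec ¬? (X? s) ×-dec ¬? (s ≟ p)) (Ro , ¬Xo , o≢p) (¬Rq ∘ proj₁)
        o≢p (λ { refl → ¬Rq Rp }) λ {s} {t} (Rs , ¬Xs , s≢p) t∉ _ t≢p e →
          let ¬Xt : ¬ X t
              ¬Xt Xt = ¬Xs (X-closed Xt (E-sym e) s≢p (λ { refl → ¬Rq Rs }))
          in case R.closed Rs e of λ where
               (inj₁ Rt) → t∉ (Rt , ¬Xt , t≢p)
               (inj₂ (inj₁ refl)) → ¬Xt Xc
               (inj₂ (inj₂ refl)) → ¬Xt Xz
      where module R = End endR

    -- The smaller end is the intersection of `R` and `X`: it can be left only through the boundary
    -- vertex `c` of `R` and the boundary vertex `p` of `X`.
    half-inside : ∀ {R z} → End E R c z → ¬ X z → z ≢ q → ¬ R q → p ≢ q → ∀ {i} → R i → X i → Smaller X c → ⊥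
    half-inside {R} {z} endR ¬Xz z≢q ¬Rq p≢q {i} Ri Xi k = k end′ proj₂ (R.p∉ ∘ proj₁)
      where
      module R = End endR
      cl : ∀ {s t} → R s × X s → E s t → (R t × X t) ⊎ t ≡ c ⊎ t ≡ p
      cl (Rs , Xs) e with R.closed Rs e | closed Xs e
      ... | _ | inj₂ (inj₁ t≡p) = inj₂ (inj₂ t≡p)
      ... | inj₂ (inj₁ t≡c) | _ = inj₂ (inj₁ t≡c)
      ... | inj₁ Rt | inj₁ Xt = inj₁ (Rt , Xt)
      ... | inj₁ Rt | inj₂ (inj₂ refl) = contradiction Rt ¬Rq
      ... | inj₂ (inj₂ refl) | inj₁ Xz = contradiction Xz ¬Xz
      ... | inj₂ (inj₂ refl) | inj₂ (inj₂ z≡q) = contradiction z≡q z≢q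
      end′ : End E (λ s → R s × X s) c p
      end′ = record
        { X? = λ s → R.X? s ×-dec X? s ; inner = i ; inner∈ = Ri , Xi
        ; p∉ = R.p∉ ∘ proj₁ ; q∉ = p∉ ∘ proj₂ ; closed = cl
        ; outer = q ; outer∉ = q∉ ∘ proj₂ ; outer≢p = ≢X q∉ Xc ; outer≢q = p≢q ∘ sym }

  -- Here `p` and `q` are on opposite sides of the second separation. If `z` is in `X`, the side
  -- containing `outer` contradicts `half-outside`; if not, a neighbour of `c` in `X` makes the
  -- intersection of `X` with one side nonempty.
  shrink₂ : ∀ {X p q c} → End E X p q → X c → ∀ {S z} → End E S c z →
            S p → ¬ S q → q ≢ z → Smaller X c → ⊥
  shrink₂ {X} {p} {q} {c} end Xc {S} {z} endS Sp ¬Sq q≢z k = go (X? z) (deg≥3 c p q)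
    where
    open End end
    module S = End endS
    p≢q : p ≢ q
    p≢q = End-≢ end
    go : Dec (X z) → (∃[ t ] E c t × t ≢ p × t ≢ q) → ⊥
    go (yes Xz) _ = case S.X? outer of λ where
      (yes So) → half-outside end Xc endS Xz Sp ¬Sq So outer∉ outer≢p
      (no ¬So) → half-outside (End-swap end) Xc (End-∁ endS) Xz
        (¬Sq , (λ { refl → q∉ Xc }) , q≢z) (λ (¬Sp , _) → ¬Sp Sp)
        (¬So , (λ { refl → outer∉ Xc }) , λ { refl → outer∉ Xz }) outer∉ outer≢q
    go (no ¬Xz) (t , ct , t≢p , t≢q) = case S.X? t of λ where
        (yes St) → half-inside end Xc endS ¬Xz (q≢z ∘ sym) ¬Sq p≢q St Xt k
        (no ¬St) → half-inside (End-swap end) Xc (End-∁ endS) ¬Xz (λ { refl → S.q∉ Sp })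
          (λ (¬Sp , _) → ¬Sp Sp) (p≢q ∘ sym)
          (¬St , (λ { refl → E-irrefl ct }) , λ { refl → ¬Xz Xt }) Xt k
      where
      Xt : X t
      Xt = X-closed end Xc Xc ct t≢p t≢q

  -- If some side of the second separation contains neither `p` nor `q`, it lies in `X`; otherwise
  -- each side contains one of them.
  shrink : ∀ {X p q c} → End E X p q → X c → ∀ {S z} → End E S c z → Smaller X c → ⊥
  shrink {X} {p} {q} {c} end Xc {S} {z} endS k = go (End.X? endS p) (End.X? endS q)
    where
    go : Dec (S p) → Dec (S q) → ⊥
    go (no ¬Sp) (no ¬Sq) = shrink₁ end Xc endS ¬Sp ¬Sq k
    go (yes Sp) (yes Sq) = shrink₁ end Xc (End-∁ endS) (λ (¬Sp , _) → ¬Sp Sp) (λ (¬Sq , _) → ¬Sq Sq) k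
    go (yes Sp) (no ¬Sq) = case q ≟ z of λ where
      (yes refl) → shrink₁ end Xc (End-∁ endS) (λ (¬Sp , _) → ¬Sp Sp) (λ (_ , _ , q≢q) → q≢q refl) k
      (no q≢z) → shrink₂ end Xc endS Sp ¬Sq q≢z k
    go (no ¬Sp) (yes Sq) = case p ≟ z of λ where
      (yes refl) → shrink₁ end Xc (End-∁ endS) (λ (_ , _ , p≢p) → p≢p refl) (λ (¬Sq , _) → ¬Sq Sq) k
      (no p≢z) → shrink₂ (End-swap end) Xc endS Sq ¬Sp p≢z k

  -- While some edge at a vertex x of the end is critical, the end beside that edge has x on its
  -- boundary, and `shrink` finds an end within the old one that misses x. The number of vertices
  -- decreases, so this stops.
  freeEnd : ∀ {X p q} → End E X p q →
            (∀ {Y r s} → End E Y r s → Y ⊆ X → Free E Y → ⊥) → ⊥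
  freeEnd end = go _ end ≤-refl
    where
    go : ∀ k {X p q} (end : End E X p q) → # (End.X? end) ≤ k →
         (∀ {Y r s} → End E Y r s → Y ⊆ X → Free E Y → ⊥) → ⊥
    go zero end #≤0 _ = case ≤-trans (#-pos (End.X? end) (End.inner∈ end)) #≤0 of λ ()
    go (suc k) {X} end #≤ κ = ¬¬-excluded-middle
      {A = ∃[ x ] ∃[ y ] X x × E x y × ¬ NonCritical E x y} λ where
        (no all-nc) → κ end id λ Xx e → NonCritical-stable λ ¬nc → all-nc (_ , _ , Xx , e , ¬nc)
        (yes (x , y , Xx , e , ¬nc)) → critCut ¬nc λ cut → shrink end Xx (cutEnd cut e) λ endY Y⊆X ¬Yx →
          go k endY (≤-pred (≤-trans (#-insert (End.X? endY) X? x Y⊆X Xx ¬Yx) #≤)) λ endZ Z⊆Y → κ endZ (Y⊆X ∘ Z⊆Y)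
      where
      open End end

  -- Off `w₁`, the far side `B₁` is left only by the edge from `b₁` to `v`, and `b₁` is not in `B₂`;
  -- likewise with the indices exchanged. A common vertex would thus turn `w₁`, `w₂` or `v` into a
  -- cut vertex.
  sides-disjoint : ∀ {v b₁ w₁ A₁ b₂ w₂ A₂} → CritCut E v b₁ w₁ A₁ → CritCut E v b₂ w₂ A₂ →
                   E v b₁ → E v b₂ → b₁ ≢ b₂ → ∀ {t} → ¬ A₁ t → t ≢ w₁ → ¬ A₂ t → t ≢ w₂ → ⊥
  sides-disjoint {v} {b₁} {w₁} {A₁} {b₂} {w₂} {A₂} cut₁ cut₂ vb₁ vb₂ b₁≢b₂ {t} ¬A₁t t≢w₁ ¬A₂t t≢w₂ =
    go (B₁? w₂) (B₂? w₁)
    where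
    module C₁ = CritCut cut₁
    module C₂ = CritCut cut₂
    B₁ B₂ : Pred V 0ℓ
    B₁ s = ¬ A₁ s × s ≢ w₁
    B₂ s = ¬ A₂ s × s ≢ w₂
    B₁? : Decidable B₁
    B₁? s = ¬? (C₁.A? s) ×-dec ¬? (s ≟ w₁)
    B₂? : Decidable B₂
    B₂? s = ¬? (C₂.A? s) ×-dec ¬? (s ≟ w₂)
    b₁∉B₂ : ¬ B₂ b₁
    b₁∉B₂ (¬A₂b₁ , b₁≢w₂) = b₁≢b₂ (proj₂ (C₂.only C₂.x∈ ¬A₂b₁ C₂.x≢z b₁≢w₂ vb₁))
    b₂∉B₁ : ¬ B₁ b₂
    b₂∉B₁ (¬A₁b₂ , b₂≢w₁) = b₁≢b₂ (sym (proj₂ (C₁.only C₁.x∈ ¬A₁b₂ C₁.x≢z b₂≢w₁ vb₂)))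
    leave₁ : ∀ {s t} → B₁ s → E s t → ¬ B₁ t → t ≢ w₁ → t ≡ v × s ≡ b₁
    leave₁ {s} {t} (¬A₁s , s≢w₁) e t∉ t≢w₁ =
      C₁.only (decidable-stable (C₁.A? t) λ ¬A₁t → t∉ (¬A₁t , t≢w₁)) ¬A₁s t≢w₁ s≢w₁ (E-sym e)
    leave₂ : ∀ {s t} → B₂ s → E s t → ¬ B₂ t → t ≢ w₂ → t ≡ v × s ≡ b₂
    leave₂ {s} {t} (¬A₂s , s≢w₂) e t∉ t≢w₂ =
      C₂.only (decidable-stable (C₂.A? t) λ ¬A₂t → t∉ (¬A₂t , t≢w₂)) ¬A₂s t≢w₂ s≢w₂ (E-sym e)
    t∈ : B₁ t × B₂ t
    t∈ = (¬A₁t , t≢w₁) , (¬A₂t , t≢w₂)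
    v≢ : ∀ {s} → B₁ s → s ≢ v
    v≢ (¬A₁v , _) refl = ¬A₁v C₁.x∈
    go : Dec (B₁ w₂) → Dec (B₂ w₁) → ⊥
    -- Each far side contains the cut vertex of the other, so their union can be left only to `v`; a
    -- third neighbour of `v` lies outside it.
    go (yes B₁w₂) (yes B₂w₁) with deg≥3 v b₁ b₂
    ... | b₃ , vb₃ , b₃≢b₁ , b₃≢b₂ =
      tc v (λ s → B₁? s ⊎-dec B₂? s) (inj₁ (proj₁ t∈)) b₃∉ (v≢ (proj₁ t∈)) (λ { refl → E-irrefl vb₃ })
        λ where
          (inj₁ B₁s) t∉ _ t≢v e → t≢v (proj₁ (leave₁ B₁s e (t∉ ∘ inj₁) (λ { refl → t∉ (inj₂ B₂w₁) })))
          (inj₂ B₂s) t∉ _ t≢v e → t≢v (proj₁ (leave₂ B₂s e (t∉ ∘ inj₂) (λ { refl → t∉ (inj₁ B₁w₂) })))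
      where
      b₃∉ : ¬ (B₁ b₃ ⊎ B₂ b₃)
      b₃∉ (inj₁ (¬A₁b₃ , b₃≢w₁)) = b₃≢b₁ (proj₂ (C₁.only C₁.x∈ ¬A₁b₃ C₁.x≢z b₃≢w₁ vb₃))
      b₃∉ (inj₂ (¬A₂b₃ , b₃≢w₂)) = b₃≢b₂ (proj₂ (C₂.only C₂.x∈ ¬A₂b₃ C₂.x≢z b₃≢w₂ vb₃))
    -- The intersection can be left only through `w₁`, since `w₂` is itself outside `B₁`.
    go (no ¬B₁w₂) _ =
      tc w₁ (λ s → B₁? s ×-dec B₂? s) t∈ (λ ((¬A₁v , _) , _) → ¬A₁v C₁.x∈) t≢w₁ C₁.x≢z
        λ {s} {t} (B₁s , B₂s) t∉ _ t≢w₁ e →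
          let B₁t = decidable-stable (B₁? t) λ ¬B₁t → case leave₁ B₁s e ¬B₁t t≢w₁ of λ { (_ , refl) → b₁∉B₂ B₂s }
              B₂t = decidable-stable (B₂? t) λ ¬B₂t →
                      case leave₂ B₂s e ¬B₂t (λ { refl → ¬B₁w₂ B₁t }) of λ { (_ , refl) → b₂∉B₁ B₁s }
          in t∉ (B₁t , B₂t)
    go _ (no ¬B₂w₁) =
      tc w₂ (λ s → B₁? s ×-dec B₂? s) t∈ (λ ((¬A₁v , _) , _) → ¬A₁v C₁.x∈) t≢w₂ C₂.x≢z
        λ {s} {t} (B₁s , B₂s) t∉ _ t≢w₂ e →
          let B₂t = decidable-stable (B₂? t) λ ¬B₂t → case leave₂ B₂s e ¬B₂t t≢w₂ of λ { (_ , refl) → b₂∉B₁ B₁s }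
              B₁t = decidable-stable (B₁? t) λ ¬B₁t →
                      case leave₁ B₁s e ¬B₁t (λ { refl → ¬B₂w₁ B₂t }) of λ { (_ , refl) → b₁∉B₂ B₂s }
          in t∉ (B₁t , B₂t)

-- Matchings: covered vertices, loads of edges, taking out an edge

module _ {n : ℕ} where

  private
    V = Fin n
    variable
      M : List (Pair n)
      x y : V

  ends : List (Pair n) → List V
  ends []            = []
  ends ((x , y) ∷ M) = x ∷ y ∷ ends M

  length-ends : ∀ M → length (ends M) ≡ length M + length M
  length-ends []      = refl
  length-ends (_ ∷ M) = cong suc (trans (cong suc (length-ends M)) (sym (+-suc _ _)))

  Covered : List (Pair n) → Pred V 0ℓ
  Covered M x = x ∈ ends M

  covered? : ∀ M → Decidable (Covered M)
  covered? M x = x ∈? ends M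
    where open DecMembership _≟_ using (_∈?_)

  mate⇒covered : EdgeIn M x y → Covered M x
  mate⇒covered {_ ∷ _} (inj₁ (here refl)) = here refl
  mate⇒covered {_ ∷ _} (inj₁ (there xy))  = there (there (mate⇒covered (inj₁ xy)))
  mate⇒covered {_ ∷ _} (inj₂ (here refl)) = there (here refl)
  mate⇒covered {_ ∷ _} (inj₂ (there yx))  = there (there (mate⇒covered (inj₂ yx)))

  covered⇒mate : ∀ M → Covered M x → ∃[ y ] EdgeIn M x y
  covered⇒mate (_ ∷ M) (here refl)         = _ , inj₁ (here refl)
  covered⇒mate (_ ∷ M) (there (here refl)) = _ , inj₂ (here refl)
  covered⇒mate (_ ∷ M) (there (there x∈)) with covered⇒mate M x∈
  ... | y , inj₁ xy = y , inj₁ (there xy)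
  ... | y , inj₂ yx = y , inj₂ (there yx)

  #-covered : ∀ M → # (covered? M) ≤ length M + length M
  #-covered M = ≤-trans (#≤count (covered? M) (ends M) id)
    (≤-trans (length-filter (covered? M) (ends M)) (≤-reflexive (length-ends M)))

  ends-unique : All (uncurry _≢_) M → AllPairs Disjoint M → Unique (ends M)
  ends-unique [] [] = []
  ends-unique {(a , b) ∷ M} (a≢b ∷ M≢) (ab ∷ M!) =
    (a≢b ∷ fresh a (λ (a≢c , a≢d , _) → a≢c , a≢d) M ab) ∷
    fresh b (λ (_ , _ , b≢c , b≢d) → b≢c , b≢d) M ab ∷ ends-unique M≢ M!
    where
    fresh : ∀ s → (∀ {c d} → Disjoint (a , b) (c , d) → s ≢ c × s ≢ d) →
            ∀ M → All (Disjoint (a , b)) M → All (s ≢_) (ends M)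
    fresh s f []      []       = []
    fresh s f (_ ∷ M) (p ∷ ps) = proj₁ (f p) ∷ proj₂ (f p) ∷ fresh s f M ps

  ⟦_⟧ : {A : Set} → Dec A → ℕ
  ⟦ yes _ ⟧ = 1
  ⟦ no _ ⟧  = 0

  count-∷∷ : {R : Pred V 0ℓ} (R? : Decidable R) → ∀ x y xs →
             count R? (x ∷ y ∷ xs) ≡ (⟦ R? x ⟧ + ⟦ R? y ⟧) + count R? xs
  count-∷∷ R? x y xs = begin
    count R? (x ∷ y ∷ xs)                 ≡⟨ count-∷ x (y ∷ xs) ⟩
    ⟦ R? x ⟧ + count R? (y ∷ xs)          ≡⟨ cong (⟦ R? x ⟧ +_) (count-∷ y xs) ⟩
    ⟦ R? x ⟧ + (⟦ R? y ⟧ + count R? xs)   ≡⟨ +-assoc ⟦ R? x ⟧ _ _ ⟨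
    (⟦ R? x ⟧ + ⟦ R? y ⟧) + count R? xs   ∎
    where
    open ≡-Reasoning
    count-∷ : ∀ x xs → count R? (x ∷ xs) ≡ ⟦ R? x ⟧ + count R? xs
    count-∷ x xs with R? x
    ... | yes _ = refl
    ... | no _  = refl

  -- Taking the mate is injective; on the list of ends it swaps the two ends of each edge, so the
  -- counts compare edge by edge.
  mates-inject : ∀ {P Q : Pred V 0ℓ} (P? : Decidable P) (Q? : Decidable Q) → Unique (ends M) →
                 (∀ {x} → P x → Covered M x) → (∀ {x y} → EdgeIn M x y → P x → Q y) → # P? ≤ # Q?
  mates-inject {M} {P} {Q} P? Q? M! P⊆ P⇒Q = ≤-trans (#≤count P? (ends M) P⊆) (≤-trans (go M P⇒Q) (count≤# Q? M!))
    where
    implies : ∀ {A B : Set} (A? : Dec A) (B? : Dec B) → (A → B) → ⟦ A? ⟧ ≤ ⟦ B? ⟧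
    implies (yes a) (yes _) _   = ≤-refl
    implies (yes a) (no ¬b) a⇒b = contradiction (a⇒b a) ¬b
    implies (no _)  _       _   = z≤n
    go : ∀ M → (∀ {x y} → EdgeIn M x y → P x → Q y) → count P? (ends M) ≤ count Q? (ends M)
    go [] _ = z≤n
    go ((x , y) ∷ M) h = begin
      count P? (x ∷ y ∷ ends M)                 ≡⟨ count-∷∷ P? x y (ends M) ⟩
      (⟦ P? x ⟧ + ⟦ P? y ⟧) + count P? (ends M)
        ≤⟨ +-mono-≤ (+-mono-≤ (implies (P? x) (Q? y) (h (inj₁ (here refl)))) (implies (P? y) (Q? x) (h (inj₂ (here refl)))))
                    (go M (λ { (inj₁ e) → h (inj₁ (there e)) ; (inj₂ e) → h (inj₂ (there e)) })) ⟩
      (⟦ Q? y ⟧ + ⟦ Q? x ⟧) + count Q? (ends M) ≡⟨ cong (_+ count Q? (ends M)) (+-comm ⟦ Q? y ⟧ ⟦ Q? x ⟧) ⟩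
      (⟦ Q? x ⟧ + ⟦ Q? y ⟧) + count Q? (ends M) ≡⟨ count-∷∷ Q? x y (ends M) ⟨
      count Q? (x ∷ y ∷ ends M)                 ∎
      where open ≤-Reasoning

  module _ {P Q : Pred V 0ℓ} (P? : Decidable P) (Q? : Decidable Q) where

    private
      -- For neighbourhoods `P` and `Q` of two uncovered vertices: the number of edges they send to
      -- the ends of x y.
      load : V → V → ℕ
      load x y = (⟦ P? x ⟧ + ⟦ P? y ⟧) + (⟦ Q? x ⟧ + ⟦ Q? y ⟧)

      -- Three of the four incidences always include both from one predicate and one from the other.
      load≤2 : ¬ (P x × P y × Q x) → ¬ (P y × P x × Q y) → ¬ (Q x × Q y × P x) → ¬ (Q y × Q x × P y) → load x y ≤ 2
      load≤2 {x} {y} h₁ h₂ h₃ h₄ with P? x | P? y | Q? x | Q? y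
      ... | yes a | yes b | yes c | _     = contradiction (a , b , c) h₁
      ... | yes a | yes b | no _  | yes d = contradiction (b , a , d) h₂
      ... | yes a | no _  | yes c | yes d = contradiction (c , d , a) h₃
      ... | no _  | yes b | yes c | yes d = contradiction (d , c , b) h₄
      ... | yes _ | yes _ | no _  | no _  = ≤-refl
      ... | yes _ | no _  | yes _ | no _  = ≤-refl
      ... | yes _ | no _  | no _  | yes _ = ≤-refl
      ... | yes _ | no _  | no _  | no _  = s≤s z≤n
      ... | no _  | yes _ | yes _ | no _  = ≤-refl
      ... | no _  | yes _ | no _  | yes _ = ≤-refl
      ... | no _  | yes _ | no _  | no _  = s≤s z≤n
      ... | no _  | no _  | yes _ | yes _ = ≤-refl
      ... | no _  | no _  | yes _ | no _  = s≤s z≤n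
      ... | no _  | no _  | no _  | yes _ = s≤s z≤n
      ... | no _  | no _  | no _  | no _  = z≤n

      load≤1 : ¬ P y → ¬ Q x → ¬ (P x × Q y) → load x y ≤ 1
      load≤1 {y} {x} ¬Py ¬Qx ¬PQ with P? x | P? y | Q? x | Q? y
      ... | _     | yes b | _     | _     = contradiction b ¬Py
      ... | _     | no _  | yes c | _     = contradiction c ¬Qx
      ... | yes a | no _  | no _  | yes d = contradiction (a , d) ¬PQ
      ... | yes _ | no _  | no _  | no _  = ≤-refl
      ... | no _  | no _  | no _  | yes _ = ≤-refl
      ... | no _  | no _  | no _  | no _  = z≤n

      load≤1′ : ¬ P y → ¬ Q x → ¬ (P x × Q y) → load y x ≤ 1
      load≤1′ {y} {x} ¬Py ¬Qx ¬PQ with P? y | P? x | Q? y | Q? x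
      ... | yes b | _     | _     | _     = contradiction b ¬Py
      ... | no _  | _     | _     | yes c = contradiction c ¬Qx
      ... | no _  | yes a | yes d | no _  = contradiction (a , d) ¬PQ
      ... | no _  | yes _ | no _  | no _  = ≤-refl
      ... | no _  | no _  | yes _ | no _  = ≤-refl
      ... | no _  | no _  | no _  | no _  = z≤n

      total : List (Pair n) → ℕ
      total M = count P? (ends M) + count Q? (ends M)

      total-∷ : ∀ x y M → total ((x , y) ∷ M) ≡ load x y + total M
      total-∷ x y M = begin
        count P? (x ∷ y ∷ ends M) + count Q? (x ∷ y ∷ ends M)
          ≡⟨ cong₂ _+_ (count-∷∷ P? x y (ends M)) (count-∷∷ Q? x y (ends M)) ⟩
        ((⟦ P? x ⟧ + ⟦ P? y ⟧) + count P? (ends M)) + ((⟦ Q? x ⟧ + ⟦ Q? y ⟧) + count Q? (ends M))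
          ≡⟨ interchange +-commutativeSemigroup (⟦ P? x ⟧ + ⟦ P? y ⟧) _ _ _ ⟩
        load x y + total M ∎
        where
        open ≡-Reasoning

      total≤ : ∀ M → All (λ (x , y) → load x y ≤ 2) M → total M ≤ length M + length M
      total≤ []            []       = z≤n
      total≤ ((x , y) ∷ M) (h ∷ hs) = begin
        total ((x , y) ∷ M)         ≡⟨ total-∷ x y M ⟩
        load x y + total M          ≤⟨ +-mono-≤ h (total≤ M hs) ⟩
        suc (suc (length M + length M)) ≡⟨ cong suc (sym (+-suc _ _)) ⟩
        length ((x , y) ∷ M) + length ((x , y) ∷ M) ∎
        where open ≤-Reasoning

      total< : ∀ M → All (λ (x , y) → load x y ≤ 2) M → (x , y) ∈ M → load x y ≤ 1 → total M < length M + length M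
      total< ((x , y) ∷ M) (_ ∷ hs) (here refl) l = begin-strict
        total ((x , y) ∷ M)         ≡⟨ total-∷ x y M ⟩
        load x y + total M          ≤⟨ +-mono-≤ l (total≤ M hs) ⟩
        suc (length M + length M)   <⟨ n<1+n _ ⟩
        suc (suc (length M + length M)) ≡⟨ cong suc (sym (+-suc _ _)) ⟩
        length ((x , y) ∷ M) + length ((x , y) ∷ M) ∎
        where open ≤-Reasoning
      total< ((x , y) ∷ M) (h ∷ hs) (there e) l = begin-strict
        total ((x , y) ∷ M)         ≡⟨ total-∷ x y M ⟩
        load x y + total M          <⟨ +-mono-≤-< h (total< M hs e l) ⟩
        suc (suc (length M + length M)) ≡⟨ cong suc (sym (+-suc _ _)) ⟩
        length ((x , y) ∷ M) + length ((x , y) ∷ M) ∎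
        where open ≤-Reasoning

    -- `noPPQ` and `noQQP` are what maximality yields by exchanging; they cap the load of every edge
    -- of `M` at 2.
    module Pairing
      (M : List (Pair n)) (P⊆ : ∀ {x} → P x → Covered M x) (Q⊆ : ∀ {x} → Q x → Covered M x)
      (noPPQ : ∀ {x y} → EdgeIn M x y → P x → P y → Q x → ⊥)
      (noQQP : ∀ {x y} → EdgeIn M x y → Q x → Q y → P x → ⊥)
      where

      private
        loads≤2 : All (λ (x , y) → load x y ≤ 2) M
        loads≤2 = All.tabulate λ xy → load≤2
          (λ (a , b , c) → noPPQ (inj₁ xy) a b c) (λ (a , b , c) → noPPQ (inj₂ xy) a b c)
          (λ (a , b , c) → noQQP (inj₁ xy) a b c) (λ (a , b , c) → noQQP (inj₂ xy) a b c)

        #+#≤total : # P? + # Q? ≤ total M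
        #+#≤total = +-mono-≤ (#≤count P? (ends M) P⊆) (#≤count Q? (ends M) Q⊆)

      #+#≤ : # P? + # Q? ≤ length M + length M
      #+#≤ = ≤-trans #+#≤total (total≤ M loads≤2)

      -- One edge with load at most 1 makes the bound strict; it will be an edge of `M` that crosses
      -- a critical cut.
      #+#< : EdgeIn M x y → ¬ P y → ¬ Q x → ¬ (P x × Q y) → # P? + # Q? < length M + length M
      #+#< (inj₁ xy) ¬Py ¬Qx ¬PQ = ≤-<-trans #+#≤total (total< M loads≤2 xy (load≤1 ¬Py ¬Qx ¬PQ))
      #+#< (inj₂ yx) ¬Py ¬Qx ¬PQ = ≤-<-trans #+#≤total (total< M loads≤2 yx (load≤1′ ¬Py ¬Qx ¬PQ))

  -- M with the edge x y taken out.
  record Without (M : List (Pair n)) (x y : V) : Set where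
    field
      rest       : List (Pair n)
      rest⊆      : ∀ {p} → p ∈ rest → p ∈ M
      disjoint   : All (Disjoint (x , y)) rest
      pairwise   : AllPairs Disjoint rest
      length≡    : suc (length rest) ≡ length M
      else       : ∀ {s t} → EdgeIn M s t → EdgeIn rest s t ⊎ (s ≡ x × t ≡ y) ⊎ (s ≡ y × t ≡ x)

  Disjoint-flip : ∀ {p : Pair n} → Disjoint (x , y) p → Disjoint (y , x) p
  Disjoint-flip (a , b , c , d) = c , d , a , b

  Disjoint-sym : ∀ {p q : Pair n} → Disjoint p q → Disjoint q p
  Disjoint-sym (a , b , c , d) = a ∘ sym , c ∘ sym , b ∘ sym , d ∘ sym

  takeOut : AllPairs Disjoint M → EdgeIn M x y → Without M x y
  takeOut M! (inj₁ xy) = go M! xy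
    where
    go : ∀ {M} → AllPairs Disjoint M → (x , y) ∈ M → Without M x y
    go (p ∷ M!) (here refl) = record
      { rest = _ ; rest⊆ = there ; disjoint = p ; pairwise = M! ; length≡ = refl
      ; else = λ where
          (inj₁ (here refl)) → inj₂ (inj₁ (refl , refl))
          (inj₁ (there e))   → inj₁ (inj₁ e)
          (inj₂ (here refl)) → inj₂ (inj₂ (refl , refl))
          (inj₂ (there e))   → inj₁ (inj₂ e) }
    go {M = q ∷ _} (p ∷ M!) (there xy) = record
      { rest = q ∷ rest
      ; rest⊆ = λ { (here refl) → here refl ; (there e) → there (rest⊆ e) }
      ; disjoint = Disjoint-sym (All.lookup p xy) ∷ disjoint
      ; pairwise = All.tabulate (λ e → All.lookup p (rest⊆ e)) ∷ pairwise
      ; length≡ = cong suc length≡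
      ; else = λ where
          (inj₁ (here refl)) → inj₁ (inj₁ (here refl))
          (inj₂ (here refl)) → inj₁ (inj₂ (here refl))
          (inj₁ (there e))   → later (else (inj₁ e))
          (inj₂ (there e))   → later (else (inj₂ e)) }
      where
      open Without (go M! xy)
      later : ∀ {A : Set} {s t} → EdgeIn rest s t ⊎ A → EdgeIn (q ∷ rest) s t ⊎ A
      later (inj₁ (inj₁ e)) = inj₁ (inj₁ (there e))
      later (inj₁ (inj₂ e)) = inj₁ (inj₂ (there e))
      later (inj₂ a)        = inj₂ a
  takeOut M! (inj₂ yx) = record
    { rest = rest ; rest⊆ = rest⊆ ; disjoint = All.map Disjoint-flip disjoint ; pairwise = pairwise
    ; length≡ = length≡
    ; else = λ e → case else e of λ where
        (inj₁ e) → inj₁ e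
        (inj₂ (inj₁ e)) → inj₂ (inj₂ e)
        (inj₂ (inj₂ e)) → inj₂ (inj₁ e) }
    where open Without (takeOut M! (inj₁ yx))

  mate-unique : AllPairs Disjoint M → ∀ {z} → EdgeIn M x y → EdgeIn M x z → x ≢ y → z ≡ y
  mate-unique M! xy xz x≢y with Without.else (takeOut M! xy) xz
  ... | inj₂ (inj₁ (_ , z≡y)) = z≡y
  ... | inj₂ (inj₂ (x≡y , _)) = contradiction x≡y x≢y
  ... | inj₁ (inj₁ e) = contradiction refl (proj₁ (All.lookup (Without.disjoint (takeOut M! xy)) e))
  ... | inj₁ (inj₂ e) = contradiction refl (proj₁ (proj₂ (All.lookup (Without.disjoint (takeOut M! xy)) e)))

module _ {n : ℕ} where

  pair? : (x y : Fin n) → Decidable (λ s → x ≡ s ⊎ y ≡ s)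
  pair? x y s = x ≟ s ⊎-dec y ≟ s

  triple? : (x y z : Fin n) → Decidable (λ s → x ≡ s ⊎ y ≡ s ⊎ z ≡ s)
  triple? x y z s = x ≟ s ⊎-dec y ≟ s ⊎-dec z ≟ s

  #-pair≤ : ∀ x y → # (pair? x y) ≤ 2
  #-pair≤ x y = ≤-trans (#-∪ (pair? x y) (x ≟_) (y ≟_) id) (+-mono-≤ (#-｛｝ x) (#-｛｝ y))

  #-pair≥ : ∀ {x y} → x ≢ y → 2 ≤ # (pair? x y)
  #-pair≥ {x} {y} x≢y = ≤-trans (s≤s (#-pos (y ≟_) refl))
    (#-insert (y ≟_) (pair? x y) x inj₂ (inj₁ refl) (x≢y ∘ sym))

  #-triple≥ : ∀ {x y z} → x ≢ y → x ≢ z → y ≢ z → 3 ≤ # (triple? x y z)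
  #-triple≥ {x} {y} {z} x≢y x≢z y≢z = ≤-trans (s≤s (#-pair≥ y≢z))
    (#-insert (pair? y z) (triple? x y z) x inj₂ (inj₁ refl)
      (λ { (inj₁ y≡x) → x≢y (sym y≡x) ; (inj₂ z≡x) → x≢z (sym z≡x) }))

-- Refuting a maximal removable matching with fewer than d edges

-- Here k = d - 2.  Everything in this module aims at ⊥, so that excluded middle
-- may be used freely.
module MaximalMatching
  {n k : ℕ} (3≤k : 3 ≤ k) (G : Graph n) (M : List (Pair n)) (isMatching : IsMatching G M)
  (size : length M ≤ suc k) (order : (2 + k) + (2 + k) ≤ n) (minDegree : MinDegree≥ (2 + k) G)
  (tc : TwoConn (Adj (G -ᴱ M)))
  (maximal : ∀ M′ → IsMatching G M′ → length M′ ≡ suc (length M) → ¬ TwoConn (Adj (G -ᴱ M′)))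
  where

  private
    V = Fin n

    E : Rel V 0ℓ
    E = Adj (G -ᴱ M)

    E? : ∀ u → Decidable (E u)
    E? = adj? (G -ᴱ M)

    E-sym : Symmetric E
    E-sym = adj-sym (G -ᴱ M)

    E-irrefl : ∀ {v} → ¬ E v v
    E-irrefl = adj-irrefl (G -ᴱ M)

    Mate : Rel V 0ℓ
    Mate = EdgeIn M

    NC : Rel V _
    NC = NonCritical E

    Cov Unc : Pred V 0ℓ
    Cov = Covered M
    Unc x = ¬ Cov x

    cov? : Decidable Cov
    cov? = covered? M

    Unc-≢ : ∀ {u x} → Unc u → Cov x → u ≢ x
    Unc-≢ ¬Cu Cu refl = ¬Cu Cu

    mate⇒adj : ∀ {x y} → Mate x y → Adj G x y
    mate⇒adj (inj₁ e) = All.lookup (proj₁ isMatching) e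
    mate⇒adj (inj₂ e) = adj-sym G (All.lookup (proj₁ isMatching) e)

    mate-≢ : ∀ {x y} → Mate x y → x ≢ y
    mate-≢ xy refl = adj-irrefl G (mate⇒adj xy)

    ends! : Unique (ends M)
    ends! = ends-unique (All.map (λ { xy refl → adj-irrefl G xy }) (proj₁ isMatching)) (proj₂ isMatching)

    degree-Unc : ∀ {v} → Unc v → 2 + k ≤ # (E? v)
    degree-Unc {v} ¬Cv = ≤-trans (minDegree v) (#-mono (adj? G v) (E? v) λ vt → vt , ¬Cv ∘ mate⇒covered)

    degree-E : ∀ v → 1 + k ≤ # (E? v)
    degree-E v with cov? v
    ... | no ¬Cv = ≤-trans (n≤1+n _) (degree-Unc ¬Cv)
    ... | yes Cv with covered⇒mate M Cv
    ...   | y , vy = ≤-pred (≤-trans (minDegree v) (#-delete (adj? G v) (E? v) y λ vt y≢t →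
              vt , λ vt∈M → y≢t (sym (mate-unique (proj₂ isMatching) vy vt∈M (mate-≢ vy)))))

    deg≥3 : ∀ c p q → ∃[ t ] E c t × t ≢ p × t ≢ q
    deg≥3 c p q with #-exceeds (E? c) (pair? p q)
                       (≤-trans (s≤s (#-pair≤ p q)) (≤-trans 3≤k (≤-trans (n≤1+n k) (degree-E c))))
    ... | t , ct , t∉ = t , ct , (λ { refl → t∉ (inj₁ refl) }) , (λ { refl → t∉ (inj₂ refl) })

  open TwoConnected E-sym E-irrefl tc
  open Ends E-sym E-irrefl tc deg≥3

  -- Augmentations

  augment-edge : ∀ {u v} → Unc u → Unc v → E u v → ¬ NC u v
  augment-edge {u} {v} ¬Cu ¬Cv (uv , _) nc = maximal ((u , v) ∷ M)
    ( uv ∷ proj₁ isMatching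
    , All.tabulate (λ p∈M → Unc-≢ ¬Cu (mate⇒covered (inj₁ p∈M)) , Unc-≢ ¬Cu (mate⇒covered (inj₂ p∈M))
                          , Unc-≢ ¬Cv (mate⇒covered (inj₁ p∈M)) , Unc-≢ ¬Cv (mate⇒covered (inj₂ p∈M)))
      ∷ proj₂ isMatching)
    refl
    (TwoConn-mono (λ ((st , st∉M) , ≢uv , ≢vu) → st , λ where
      (inj₁ (here refl)) → ≢uv (refl , refl)
      (inj₂ (here refl)) → ≢vu (refl , refl)
      (inj₁ (there e))   → st∉M (inj₁ e)
      (inj₂ (there e))   → st∉M (inj₂ e)) nc)

  -- The path u y x v is augmenting. `robust` isolates the reason why the outcome is 2-connected,
  -- which differs between the two exchanges.
  augment-path : ∀ {u v x y} → Mate x y → Unc u → Unc v → u ≢ v → E u y → E v x →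
    (∀ {E′ : Rel V 0ℓ} → Symmetric E′ → (∀ {s t} → ((E ∖⟨ u , y ⟩) ∖⟨ v , x ⟩) s t → E′ s t) →
     E′ x y → TwoConn E′) → ⊥
  augment-path {u} {v} {x} {y} xy ¬Cu ¬Cv u≢v (uy , _) (vx , _) robust = maximal M′
    ( uy ∷ vx ∷ All.tabulate (λ e → All.lookup (proj₁ isMatching) (rest⊆ e))
    , ((u≢v , u≢x , v≢y ∘ sym , mate-≢ xy ∘ sym) ∷
       All.tabulate (λ e → new ¬Cu (rest⊆ e) (λ (_ , _ , d) → d) (All.lookup disjoint e)))
      ∷ All.tabulate (λ e → new ¬Cv (rest⊆ e) (λ (a , b , _) → a , b) (All.lookup disjoint e))
      ∷ pairwise )
    (cong suc length≡)
    (robust (adj-sym (G -ᴱ M′)) sub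
      (mate⇒adj xy , λ where
        (inj₁ (here refl)) → u≢x refl
        (inj₂ (here refl)) → u≢y refl
        (inj₁ (there (here refl))) → v≢x refl
        (inj₂ (there (here refl))) → v≢y refl
        (inj₁ (there (there e))) → proj₁ (All.lookup disjoint e) refl
        (inj₂ (there (there e))) → proj₁ (proj₂ (All.lookup disjoint e)) refl))
    where
    open Without (takeOut (proj₂ isMatching) xy)
    M′ = (u , y) ∷ (v , x) ∷ rest
    Cx = mate⇒covered xy
    Cy = mate⇒covered (swap xy)
    u≢x = Unc-≢ ¬Cu Cx
    u≢y = Unc-≢ ¬Cu Cy
    v≢x = Unc-≢ ¬Cv Cx
    v≢y = Unc-≢ ¬Cv Cy
    new : ∀ {u s a b} → Unc u → (a , b) ∈ M → (Disjoint (x , y) (a , b) → s ≢ a × s ≢ b) →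
          Disjoint (x , y) (a , b) → Disjoint (u , s) (a , b)
    new ¬Cu e f d = Unc-≢ ¬Cu (mate⇒covered (inj₁ e)) , Unc-≢ ¬Cu (mate⇒covered (inj₂ e)) , f d
    sub : ∀ {s t} → ((E ∖⟨ u , y ⟩) ∖⟨ v , x ⟩) s t → Adj (G -ᴱ M′) s t
    sub (((st , st∉M) , ≢uy , ≢yu) , ≢vx , ≢xv) = st , λ where
      (inj₁ (here refl)) → ≢uy (refl , refl)
      (inj₂ (here refl)) → ≢yu (refl , refl)
      (inj₁ (there (here refl))) → ≢vx (refl , refl)
      (inj₂ (there (here refl))) → ≢xv (refl , refl)
      (inj₁ (there (there e))) → st∉M (inj₁ (rest⊆ e))
      (inj₂ (there (there e))) → st∉M (inj₂ (rest⊆ e))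

  no-exchange : ∀ {u v x y} → Mate x y → Unc u → Unc v → u ≢ v →
                E u x → E u y → E v x → NC u y → NC v x → ⊥
  no-exchange xy ¬Cu ¬Cv u≢v ux uy vx nc-uy nc-vx =
    augment-path xy ¬Cu ¬Cv u≢v uy vx λ E′-sym sub xy′ →
      exchange E′-sym sub xy′ u≢v (mate-≢ xy) ux nc-uy nc-vx

  no-crossExchange : ∀ {u b w A v x y} → Mate x y → Unc u → Unc v → u ≢ v →
    E u b → CritCut E u b w A → A x → ¬ A y → x ≢ w → y ≢ w →
    E u x → E v y → NC u x → NC v y → ⊥
  no-crossExchange xy ¬Cu ¬Cv u≢v ub cut Ax ¬Ay x≢w y≢w ux vy nc-ux nc-vy =
    augment-path (swap xy) ¬Cu ¬Cv u≢v ux vy λ E′-sym sub yx′ →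
      crossExchange E′-sym sub (E′-sym yx′) u≢v ub cut Ax ¬Ay x≢w y≢w ux nc-ux nc-vy

  -- Sizes of ends

  module _ {X p q} (end : End E X p q) where
    open End end

    private
      boundary? : Decidable (λ s → X s ⊎ p ≡ s ⊎ q ≡ s)
      boundary? s = X? s ⊎-dec pair? p q s

    -- A vertex of `X` has all its neighbours in `X` and the boundary, so nonneighbours found there
    -- push up the size of `X`.
    nonneighbours : ∀ {x} {P : Pred V 0ℓ} → X x → (P? : Decidable P) → (∀ {s} → P s → X s ⊎ p ≡ s ⊎ q ≡ s) →
                    (∀ {s} → E x s → P s → ⊥) → # (E? x) + # P? ≤ # X? + 2
    nonneighbours {x} Xx P? P⊆ E⊥P = ≤-trans
      (#-⊎ boundary? (E? x) P? (λ e → case closed Xx e of λ where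
        (inj₁ Xs) → inj₁ Xs
        (inj₂ (inj₁ s≡p)) → inj₂ (inj₁ (sym s≡p))
        (inj₂ (inj₂ s≡q)) → inj₂ (inj₂ (sym s≡q))) P⊆ E⊥P)
      (≤-trans (#-∪ boundary? X? (pair? p q) id) (+-monoʳ-≤ (# X?) (#-pair≤ p q)))

    private
      +≤+2 : ∀ {a b c} j → a ≤ c → j + 2 ≤ b → c + b ≤ # X? + 2 → a + j ≤ # X?
      +≤+2 {a} {b} {c} j a≤c j+2≤b c+b≤ = +-cancelʳ-≤ 2 (a + j) (# X?) (begin
        a + j + 2   ≡⟨ +-assoc a j 2 ⟩
        a + (j + 2) ≤⟨ +-mono-≤ a≤c j+2≤b ⟩
        c + b       ≤⟨ c+b≤ ⟩
        # X? + 2    ∎)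
        where open ≤-Reasoning

    size₀ : ∀ {x d} → X x → d ≤ # (E? x) → d ≤ suc (# X?)
    size₀ {x} {d} Xx d≤ = +-cancelʳ-≤ 1 d (suc (# X?)) (begin
        d + 1              ≤⟨ +-mono-≤ d≤ (#-pos (x ≟_) refl) ⟩
        # (E? x) + # (x ≟_) ≤⟨ nonneighbours Xx (x ≟_) (λ { refl → inj₁ Xx }) (λ { e refl → E-irrefl e }) ⟩
        # X? + 2           ≡⟨ +-suc (# X?) 1 ⟩
        suc (# X?) + 1     ∎)
        where open ≤-Reasoning

    -- The nonneighbours `x` and `t` offset the two boundary vertices, so the degree bound passes to
    -- `X`.
    size₁ : ∀ {x t} → X x → x ≢ t → X t ⊎ p ≡ t ⊎ q ≡ t → ¬ E x t → 1 + k ≤ # X?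
    size₁ {x} {t} Xx x≢t t∈ ¬xt = ≤-trans (≤-reflexive (sym (+-identityʳ _))) (+≤+2 0 (degree-E x) (#-pair≥ x≢t)
      (nonneighbours Xx (pair? x t) (λ { (inj₁ refl) → inj₁ Xx ; (inj₂ refl) → t∈ })
        (λ { e (inj₁ refl) → E-irrefl e ; e (inj₂ refl) → ¬xt e })))

    size₂ : ∀ {x t t′} → X x → x ≢ t → x ≢ t′ → t ≢ t′ → X t ⊎ p ≡ t ⊎ q ≡ t → X t′ ⊎ p ≡ t′ ⊎ q ≡ t′ →
            ¬ E x t → ¬ E x t′ → 2 + k ≤ # X?
    size₂ {x} {t} {t′} Xx x≢t x≢t′ t≢t′ t∈ t′∈ ¬xt ¬xt′ = ≤-trans (≤-reflexive (+-comm 1 (suc k)))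
      (+≤+2 1 (degree-E x) (#-triple≥ x≢t x≢t′ t≢t′)
      (nonneighbours Xx (triple? x t t′)
        (λ { (inj₁ refl) → inj₁ Xx ; (inj₂ (inj₁ refl)) → t∈ ; (inj₂ (inj₂ refl)) → t′∈ })
        (λ { e (inj₁ refl) → E-irrefl e ; e (inj₂ (inj₁ refl)) → ¬xt e ; e (inj₂ (inj₂ refl)) → ¬xt′ e })))

  -- Edges from uncovered vertices to the matching

  -- Taking b = u expresses that no edge at u is critical.
  CriticalOnlyAt : V → V → Set₁
  CriticalOnlyAt u b = ∀ {t} → E u t → b ≢ t → NC u t

  private
    nbr? : ∀ u b → Decidable (λ t → E u t × b ≢ t)
    nbr? u b t = E? u t ×-dec ¬? (b ≟ t)

    #nbr : ∀ {u} → Unc u → ∀ b → 1 + k ≤ # (nbr? u b)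
    #nbr {u} ¬Cu b = ≤-pred (≤-trans (degree-Unc ¬Cu) (#-delete (E? u) (nbr? u b) b _,_))

    #nbr-self : ∀ {u} → Unc u → 2 + k ≤ # (nbr? u u)
    #nbr-self {u} ¬Cu = ≤-trans (degree-Unc ¬Cu) (#-mono (E? u) (nbr? u u) λ ut → ut , λ { refl → E-irrefl ut })

    #Cov≤ : # cov? ≤ (1 + k) + (1 + k)
    #Cov≤ = ≤-trans (#-covered M) (+-mono-≤ size size)

  module _ {u v b c} (¬Cu : Unc u) (¬Cv : Unc v) (u≢v : u ≢ v)
           (critᵤ : CriticalOnlyAt u b) (critᵥ : CriticalOnlyAt v c) where

    private
      ⊆Cov : ∀ {u b} → Unc u → CriticalOnlyAt u b → ∀ {t} → E u t × b ≢ t → Cov t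
      ⊆Cov ¬Cu crit {t} (ut , b≢t) = decidable-stable (cov? t) λ ¬Ct → augment-edge ¬Cu ¬Ct ut (crit ut b≢t)

    -- A non-critical edge from an uncovered vertex leads to a covered one, and `no-exchange`
    -- forbids load 3.
    open Pairing (nbr? u b) (nbr? v c) M (⊆Cov ¬Cu critᵤ) (⊆Cov ¬Cv critᵥ)
      (λ xy (ux , _) (uy , b≢y) (vx , c≢x) → no-exchange xy ¬Cu ¬Cv u≢v ux uy vx (critᵤ uy b≢y) (critᵥ vx c≢x))
      (λ xy (vx , _) (vy , c≢y) (ux , b≢x) → no-exchange xy ¬Cv ¬Cu (u≢v ∘ sym) vx vy ux (critᵥ vy c≢y) (critᵤ ux b≢x))
      public

  -- `u` sends at least 2 + k edges to `M` and `v` at least 1 + k, together more than 1 + k edges of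
  -- `M` can receive at two each.
  at-most-one-uncritical : ∀ {u v c} → Unc u → Unc v → u ≢ v → CriticalOnlyAt u u → CriticalOnlyAt v c → ⊥
  at-most-one-uncritical {c = c} ¬Cu ¬Cv u≢v ncᵤ critᵥ = 1+n≰n (≤-trans (+-mono-≤ (#nbr-self ¬Cu) (#nbr ¬Cv c))
    (≤-trans (#+#≤ ¬Cu ¬Cv u≢v ncᵤ critᵥ) (+-mono-≤ size size)))

  Free⇒uncritical : ∀ {X x} → Free E X → X x → CriticalOnlyAt x x
  Free⇒uncritical free Xx e _ = free Xx e

  -- Three such sets have at least 3 k elements, while at most 2 (1 + k) vertices are covered;
  -- `3 ≤ k` makes this absurd.
  no-three : ∀ {P Q R : Pred V 0ℓ} (P? : Decidable P) (Q? : Decidable Q) (R? : Decidable R) →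
    P ⊆ Cov → Q ⊆ Cov → R ⊆ Cov →
    (∀ {x} → P x → Q x → ⊥) → (∀ {x} → P x → R x → ⊥) → (∀ {x} → Q x → R x → ⊥) →
    k ≤ # P? → k ≤ # Q? → k ≤ # R? → ⊥
  no-three P? Q? R? P⊆ Q⊆ R⊆ PQ PR QR k≤P k≤Q k≤R = 1+n≰n (begin
    suc ((1 + k) + (1 + k)) ≡⟨ eq k ⟩
    3 + (k + k)             ≤⟨ +-mono-≤ 3≤k ≤-refl ⟩
    k + (k + k)             ≤⟨ +-mono-≤ k≤P (+-mono-≤ k≤Q k≤R) ⟩
    # P? + (# Q? + # R?)    ≤⟨ +-monoʳ-≤ (# P?) (#-⊎ Q∪R? Q? R? inj₁ inj₂ QR) ⟩
    # P? + # Q∪R?           ≤⟨ #-⊎ cov? P? Q∪R? P⊆ (λ { (inj₁ q) → Q⊆ q ; (inj₂ r) → R⊆ r })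
                                 (λ { p (inj₁ q) → PQ p q ; p (inj₂ r) → PR p r }) ⟩
    # cov?                  ≤⟨ #Cov≤ ⟩
    (1 + k) + (1 + k)       ∎)
    where
    open ≤-Reasoning
    Q∪R? : Decidable (λ x → _ ⊎ _)
    Q∪R? x = Q? x ⊎-dec R? x
    eq : ∀ k → suc ((1 + k) + (1 + k)) ≡ 3 + (k + k)
    eq = solve-∀

  -- Two uncovered vertices in a free end would both be uncritical, so there is at most one. If
  -- there is one, its larger degree gives an extra vertex, which makes up for it.
  free-size : ∀ {X p q} (end : End E X p q) → Free E X → k ≤ # (End.X? end ∩? cov?)
  free-size {X} end free with any? (End.X? end ∩? ∁? cov?)
  ... | yes (x , Xx , ¬Cx) = ≤-pred (≤-trans (≤-pred (size₀ end Xx (degree-Unc ¬Cx)))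
        (#-delete (End.X? end) (End.X? end ∩? cov?) x λ {y} Xy x≢y → Xy , decidable-stable (cov? y) λ ¬Cy →
          at-most-one-uncritical ¬Cx ¬Cy x≢y (Free⇒uncritical free Xx) (Free⇒uncritical free Xy)))
  ... | no ∄ = ≤-trans (≤-pred (size₀ end (End.inner∈ end) (degree-E _)))
        (#-mono (End.X? end) (End.X? end ∩? cov?) λ {y} Xy → Xy , decidable-stable (cov? y) λ ¬Cy → ∄ (y , Xy , ¬Cy))

  -- The end is sought on the side of b because the far sides of different critical edges at v are
  -- disjoint.
  farEnd : ∀ {v b} → E v b → ¬ NC v b →
    (∀ {w A X p q} → CritCut E v b w A → End E X p q → Free E X →
     (∀ {t} → X t → ¬ A t × t ≢ b × t ≢ w) → ⊥) → ⊥
  farEnd vb ¬nc κ = critCut ¬nc λ cut →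
    freeEnd (cutEnd (CritCut-swap cut) (E-sym vb)) λ end X⊆ free → κ cut end free X⊆

  -- The far sides give two disjoint free ends, neither containing a neighbour of v. The remaining
  -- neighbours of v, at least k of them, are the third set for `no-three`, unless one is uncovered.
  two-critical : ∀ {v b₁ b₂} → Unc v → E v b₁ → E v b₂ → b₁ ≢ b₂ → ¬ NC v b₁ → ¬ NC v b₂ → ⊥
  two-critical {v} {b₁} {b₂} ¬Cv vb₁ vb₂ b₁≢b₂ ¬nc₁ ¬nc₂ =
    farEnd vb₁ ¬nc₁ λ {_} {A₁} {X₁} cut₁ end₁ free₁ X₁⊆ → farEnd vb₂ ¬nc₂ λ {_} {A₂} {X₂} cut₂ end₂ free₂ X₂⊆ →
    let module C₁ = CritCut cut₁
        module C₂ = CritCut cut₂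
        module X₁ = End end₁
        module X₂ = End end₂
        X₁⊥X₂ : ∀ {x} → X₁ x → X₂ x → ⊥
        X₁⊥X₂ x₁ x₂ = sides-disjoint cut₁ cut₂ vb₁ vb₂ b₁≢b₂ (proj₁ (X₁⊆ x₁)) (proj₂ (proj₂ (X₁⊆ x₁)))
                        (proj₁ (X₂⊆ x₂)) (proj₂ (proj₂ (X₂⊆ x₂)))
        v≁X₁ : ∀ {x} → E v x → X₁ x → ⊥
        v≁X₁ e x = let ¬A , x≢b , x≢w = X₁⊆ x in x≢b (proj₂ (C₁.only C₁.x∈ ¬A C₁.x≢z x≢w e))
        v≁X₂ : ∀ {x} → E v x → X₂ x → ⊥
        v≁X₂ e x = let ¬A , x≢b , x≢w = X₂⊆ x in x≢b (proj₂ (C₂.only C₂.x∈ ¬A C₂.x≢z x≢w e))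
        others? : Decidable (λ t → E v t × b₁ ≢ t × b₂ ≢ t)
        others? t = E? v t ×-dec ¬? (b₁ ≟ t) ×-dec ¬? (b₂ ≟ t)
        k≤others : k ≤ # others?
        k≤others = ≤-pred (≤-trans (#nbr ¬Cv b₁) (#-delete (nbr? v b₁) others? b₂ λ (e , b₁≢t) b₂≢t → e , b₁≢t , b₂≢t))
    in case any? (others? ∩? ∁? cov?) of λ where
         (no ∄) → no-three (X₁.X? ∩? cov?) (X₂.X? ∩? cov?) others? proj₂ proj₂
           (λ {t} o → decidable-stable (cov? t) λ ¬Ct → ∄ (t , o , ¬Ct))
           (λ (x₁ , _) (x₂ , _) → X₁⊥X₂ x₁ x₂) (λ (x₁ , _) (e , _) → v≁X₁ e x₁) (λ (x₂ , _) (e , _) → v≁X₂ e x₂)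
           (free-size end₁ free₁) (free-size end₂ free₂) k≤others
         -- By maximality the edge to an uncovered neighbour is critical, and its far side holds a
         -- third free end.
         (yes (b₃ , (vb₃ , b₁≢b₃ , b₂≢b₃) , ¬Cb₃)) →
           farEnd vb₃ (augment-edge ¬Cv ¬Cb₃ vb₃) λ cut₃ end₃ free₃ X₃⊆ →
             no-three (X₁.X? ∩? cov?) (X₂.X? ∩? cov?) (End.X? end₃ ∩? cov?) proj₂ proj₂ proj₂
               (λ (x₁ , _) (x₂ , _) → X₁⊥X₂ x₁ x₂)
               (λ (x₁ , _) (x₃ , _) → sides-disjoint cut₁ cut₃ vb₁ vb₃ b₁≢b₃ (proj₁ (X₁⊆ x₁)) (proj₂ (proj₂ (X₁⊆ x₁)))
                        (proj₁ (X₃⊆ x₃)) (proj₂ (proj₂ (X₃⊆ x₃))))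
               (λ (x₂ , _) (x₃ , _) → sides-disjoint cut₂ cut₃ vb₂ vb₃ b₂≢b₃ (proj₁ (X₂⊆ x₂)) (proj₂ (proj₂ (X₂⊆ x₂)))
                        (proj₁ (X₃⊆ x₃)) (proj₂ (proj₂ (X₃⊆ x₃))))
               (free-size end₁ free₁) (free-size end₂ free₂) (free-size end₃ free₃)

  critical-only-at : ∀ {u b} → Unc u → E u b → ¬ NC u b → CriticalOnlyAt u b
  critical-only-at ¬Cu ub ¬nc ut b≢t = NonCritical-stable (two-critical ¬Cu ub ut b≢t ¬nc)

  -- A free end on each side of a critical edge u b.
  record TwoEnds (u b : V) : Set₁ where
    field
      {w p₁ q₁ p₂ q₂} : V
      {A X₁ X₂}       : Pred V 0ℓ
      cut             : CritCut E u b w A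
      end₁            : End E X₁ p₁ q₁
      end₂            : End E X₂ p₂ q₂
      free₁           : Free E X₁
      free₂           : Free E X₂
      X₁⊆             : ∀ {t} → X₁ t → A t × t ≢ u × t ≢ w
      X₂⊆             : ∀ {t} → X₂ t → ¬ A t × t ≢ b × t ≢ w

  twoEnds : ∀ {u b} → E u b → ¬ NC u b → (TwoEnds u b → ⊥) → ⊥
  twoEnds ub ¬nc κ = critCut ¬nc λ cut →
    freeEnd (cutEnd cut ub) λ end₁ X₁⊆ free₁ →
    freeEnd (cutEnd (CritCut-swap cut) (E-sym ub)) λ end₂ X₂⊆ free₂ →
    κ (record { cut = cut ; end₁ = end₁ ; end₂ = end₂ ; free₁ = free₁ ; free₂ = free₂ ; X₁⊆ = X₁⊆ ; X₂⊆ = X₂⊆ })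

  -- The two free ends beside a critical edge

  module AroundCritical {u b} (¬Cu : Unc u) (ub : E u b) (¬nc : ¬ NC u b) (twoEnds : TwoEnds u b) where
    open TwoEnds twoEnds
    open CritCut cut
    module X₁ = End end₁
    module X₂ = End end₂

    critᵤ : CriticalOnlyAt u b
    critᵤ = critical-only-at ¬Cu ub ¬nc

    -- An uncovered vertex of a free end is uncritical, and `u` has a single critical edge, so
    -- `at-most-one-uncritical` applies.
    X₁⊆Cov : X₁ ⊆ Cov
    X₁⊆Cov {x} x₁ = decidable-stable (cov? x) λ ¬Cx →
      at-most-one-uncritical ¬Cx ¬Cu (proj₁ (proj₂ (X₁⊆ x₁))) (Free⇒uncritical free₁ x₁) critᵤ

    X₂⊆Cov : X₂ ⊆ Cov
    X₂⊆Cov {x} x₂ = decidable-stable (cov? x) λ ¬Cx →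
      at-most-one-uncritical ¬Cx ¬Cu (λ { refl → proj₁ (X₂⊆ x₂) x∈ }) (Free⇒uncritical free₂ x₂) critᵤ

    X₁⊥X₂ : ∀ {x} → X₁ x → X₂ x → ⊥
    X₁⊥X₂ x₁ x₂ = proj₁ (X₂⊆ x₂) (proj₁ (X₁⊆ x₁))

    Z : Pred V 0ℓ
    Z x = Cov x × ¬ X₁ x × ¬ X₂ x

    Z? : Decidable Z
    Z? x = cov? x ×-dec ¬? (X₁.X? x) ×-dec ¬? (X₂.X? x)

    X₁∪Z? : Decidable (X₁ ∪ Z)
    X₁∪Z? x = X₁.X? x ⊎-dec Z? x

    #X₂+#X₁∪Z≤ : # X₂.X? + # X₁∪Z? ≤ (1 + k) + (1 + k)
    #X₂+#X₁∪Z≤ = ≤-trans (#-⊎ cov? X₂.X? X₁∪Z? X₂⊆Cov (λ { (inj₁ x₁) → X₁⊆Cov x₁ ; (inj₂ (Cx , _)) → Cx })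
      (λ { x₂ (inj₁ x₁) → X₁⊥X₂ x₁ x₂ ; x₂ (inj₂ (_ , _ , ¬x₂)) → ¬x₂ x₂ })) #Cov≤

    #X₁+#Z≤ : # X₁.X? + # Z? ≤ # X₁∪Z?
    #X₁+#Z≤ = #-⊎ X₁∪Z? X₁.X? Z? inj₁ inj₂ (λ x₁ (_ , ¬x₁ , _) → ¬x₁ x₁)

    k≤X₁ : k ≤ # X₁.X?
    k≤X₁ = ≤-pred (size₀ end₁ X₁.inner∈ (degree-E _))

    k≤X₂ : k ≤ # X₂.X?
    k≤X₂ = ≤-pred (size₀ end₂ X₂.inner∈ (degree-E _))

    Z<k : k ≤ # Z? → ⊥
    Z<k = no-three X₁.X? X₂.X? Z? X₁⊆Cov X₂⊆Cov proj₁ X₁⊥X₂ (λ x₁ (_ , ¬x₁ , _) → ¬x₁ x₁)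
            (λ x₂ (_ , _ , ¬x₂) → ¬x₂ x₂) k≤X₁ k≤X₂

    -- Such an edge would cross the cut, hence be u b, but u is not in `X₁`.
    X₁-X₂ : ∀ {x s} → X₂ x → X₁ s → ¬ E s x
    X₁-X₂ x₂ s₁ e = let As , s≢u , s≢w = X₁⊆ s₁ ; ¬Ax , _ , x≢w = X₂⊆ x₂
                    in s≢u (proj₁ (only As ¬Ax s≢w x≢w e))

    u≁X₂ : ∀ {x} → X₂ x → ¬ E u x
    u≁X₂ x₂ e = let ¬Ax , x≢b , x≢w = X₂⊆ x₂ in x≢b (proj₂ (only x∈ ¬Ax x≢z x≢w e))

    -- Mates are not adjacent in `E`, so `y` serves as a second nonneighbour of `x`.
    internal⇒size₁ : ∀ {x y} → Mate x y → X₁ x → X₁ y → 1 + k ≤ # X₁.X?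
    internal⇒size₁ xy x₁ y₁ = size₁ end₁ x₁ (mate-≢ xy) (inj₁ y₁) (λ (_ , xy∉M) → xy∉M xy)

    internal⇒size₂ : ∀ {x y} → Mate x y → X₂ x → X₂ y → 1 + k ≤ # X₂.X?
    internal⇒size₂ xy x₂ y₂ = size₁ end₂ x₂ (mate-≢ xy) (inj₁ y₂) (λ (_ , xy∉M) → xy∉M xy)

    -- If all mates of `X₁` were in `Z`, there would be at least k of them. So, on the way to `⊥`,
    -- an edge of `M` from `X₁` to `X₁` or `X₂` may be assumed: the one that `h` receives.
    mates-of-X₁ : (∀ {x y} → Mate x y → X₁ x → X₁ y ⊎ X₂ y → ⊥) → ⊥
    mates-of-X₁ h = Z<k (≤-trans k≤X₁ (mates-inject X₁.X? Z? ends! X₁⊆Cov λ xy x₁ →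
      mate⇒covered (swap xy) , h xy x₁ ∘ inj₁ , h xy x₁ ∘ inj₂))

    mates-of-X₂ : (∀ {x y} → Mate x y → X₂ x → X₁ y ⊎ X₂ y → ⊥) → ⊥
    mates-of-X₂ h = Z<k (≤-trans k≤X₂ (mates-inject X₂.X? Z? ends! X₂⊆Cov λ xy x₂ →
      mate⇒covered (swap xy) , h xy x₂ ∘ inj₁ , h xy x₂ ∘ inj₂))

  -- Each edge of M receives two of the edges from u and b, which excludes edges of
  -- M between the two ends; so both ends contain edges of M, are as small as that
  -- allows, and exhaust the covered vertices.  The boundary of an end is then
  -- uncovered and joined to both endpoints of an edge of M inside it.
  uncovered-independent : ∀ {u b} → Unc u → Unc b → ¬ E u b
  uncovered-independent {u} {b} ¬Cu ¬Cb ub = twoEnds ub ¬nc go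
    where
    ¬nc = augment-edge ¬Cu ¬Cb ub
    go : TwoEnds u b → ⊥
    go two = mates-of-X₂ λ where
        xy x₂ (inj₁ y₁) → no-crossing (swap xy) y₁ x₂
        xy x₂ (inj₂ y₂) → mates-of-X₁ λ where
          st s₁ (inj₂ t₂) → no-crossing st s₁ t₂
          st s₁ (inj₁ t₁) → tight st s₁ t₁ (internal⇒size₁ st s₁ t₁) (internal⇒size₂ xy x₂ y₂)
      where
      open TwoEnds two
      open AroundCritical ¬Cu ub ¬nc two
      open CritCut cut

      critᵇ : CriticalOnlyAt b u
      critᵇ = critical-only-at ¬Cb (E-sym ub) (λ nc → ¬nc (NonCritical-sym nc))

      u≢b : u ≢ b
      u≢b refl = E-irrefl ub

      no-crossing : ∀ {x y} → Mate x y → X₁ x → X₂ y → ⊥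
      -- The cut keeps `u` from `y` and `b` from `x`, and u x together with b y would allow a cross
      -- exchange; so x y has load at most 1, although at least 2 (1 + k) edges arrive at `M`.
      no-crossing {x} {y} xy x₁ y₂ = let Ax , x≢u , x≢w = X₁⊆ x₁ ; ¬Ay , y≢b , y≢w = X₂⊆ y₂ in
        1+n≰n (≤-trans (#+#< ¬Cu ¬Cb u≢b critᵤ critᵇ xy
          (λ (uy , _) → u≁X₂ y₂ uy)
          (λ (bx , _) → x≢u (proj₁ (only Ax y∉ x≢w y≢z (E-sym bx))))
          (λ ((ux , b≢x) , (by , u≢y)) →
            no-crossExchange xy ¬Cu ¬Cb u≢b ub cut Ax ¬Ay x≢w y≢w ux by (critᵤ ux b≢x) (critᵇ by u≢y)))
          (≤-trans (+-mono-≤ size size) (+-mono-≤ (#nbr ¬Cu b) (#nbr ¬Cb u))))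

      tight : ∀ {x y} → Mate x y → X₁ x → X₁ y → 1 + k ≤ # X₁.X? → 1 + k ≤ # X₂.X? → ⊥
      tight {x} {y} xy x₁ y₁ 1+k≤X₁ 1+k≤X₂ =
        no-exchange xy (boundary-Unc p-near x₁ (E-sym (meet x₁ y₁ xy p-near)))
                       (boundary-Unc q-near x₁ (E-sym (meet x₁ y₁ xy q-near))) (End-≢ end₁)
          (E-sym (meet x₁ y₁ xy p-near)) (E-sym (meet y₁ x₁ (swap xy) p-near)) (E-sym (meet x₁ y₁ xy q-near))
          (NonCritical-sym (free₁ y₁ (meet y₁ x₁ (swap xy) p-near)))
          (NonCritical-sym (free₁ x₁ (meet x₁ y₁ xy q-near)))
        where
        open ≤-Reasoning
        Boundary : Pred V 0ℓ
        Boundary r = ¬ X₁ r × (X₁ r ⊎ p₁ ≡ r ⊎ q₁ ≡ r)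
        p-near : Boundary p₁
        p-near = X₁.p∉ , inj₂ (inj₁ refl)
        q-near : Boundary q₁
        q-near = X₁.q∉ , inj₂ (inj₂ refl)
        -- Two ends with 1 + k vertices each use up all covered vertices.
        Z-empty : ∀ {z} → ¬ Z z
        Z-empty Zz = 1+n≰n (begin
          suc ((1 + k) + (1 + k)) ≡⟨ eq k ⟩
          (1 + k) + ((1 + k) + 1) ≤⟨ +-mono-≤ 1+k≤X₂ (≤-trans (+-mono-≤ 1+k≤X₁ (#-pos Z? Zz)) #X₁+#Z≤) ⟩
          # X₂.X? + # X₁∪Z?       ≤⟨ #X₂+#X₁∪Z≤ ⟩
          (1 + k) + (1 + k)       ∎)
          where
          eq : ∀ k → suc ((1 + k) + (1 + k)) ≡ (1 + k) + ((1 + k) + 1)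
          eq = solve-∀
        X₁-small : 2 + k ≤ # X₁.X? → ⊥
        X₁-small 2+k≤ = 1+n≰n (begin
          suc ((1 + k) + (1 + k)) ≡⟨ sym (+-suc (1 + k) (1 + k)) ⟩
          (1 + k) + (2 + k)       ≤⟨ +-mono-≤ 1+k≤X₂ (≤-trans 2+k≤ (≤-trans (m≤m+n _ _) #X₁+#Z≤)) ⟩
          # X₂.X? + # X₁∪Z?       ≤⟨ #X₂+#X₁∪Z≤ ⟩
          (1 + k) + (1 + k)       ∎)
        -- A boundary vertex missed by `x` would be a third nonneighbour, after `x` and its mate,
        -- and make `X₁` too large.
        meet : ∀ {x y r} → X₁ x → X₁ y → Mate x y → Boundary r → E x r
        meet {x} {y} {r} x₁ y₁ xy (¬Xr , r∈) = decidable-stable (E? x r) λ ¬xr →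
          X₁-small (size₂ end₁ x₁ (mate-≢ xy) (λ { refl → ¬Xr x₁ }) (λ { refl → ¬Xr y₁ }) (inj₁ y₁) r∈
            (λ (_ , xy∉M) → xy∉M xy) ¬xr)
        -- A covered vertex outside `X₁` is now in `X₂`, which sends no edge to `X₁`.
        boundary-Unc : ∀ {x r} → Boundary r → X₁ x → E r x → Unc r
        boundary-Unc (¬X₁r , _) x₁ rx Cr = Z-empty (Cr , ¬X₁r , λ r₂ → X₁-X₂ r₂ x₁ (E-sym rx))

  -- Now u has all its neighbours outside X₂, so X₂ is as small as possible and some
  -- edge of M joins it to X₁.  The boundary of X₂ is then b and w, and v is joined
  -- to X₁ and to b, across the cut.
  no-critical : ∀ {u v b} → Unc u → Unc v → u ≢ v → E u b → ¬ NC u b → ⊥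
  no-critical {u} {v} {b} ¬Cu ¬Cv u≢v ub ¬nc = twoEnds ub ¬nc go
    where
    go : TwoEnds u b → ⊥
    go two = mates-of-X₂ λ where
        xy x₂ (inj₂ y₂) → X₂-small (internal⇒size₂ xy x₂ y₂)
        yx y₂ (inj₁ x₁) → main (boundary-Z (swap yx) x₁ y₂ p-near) (boundary-Z (swap yx) x₁ y₂ q-near)
      where
      open TwoEnds two
      open AroundCritical ¬Cu ub ¬nc two
      open CritCut cut
      open ≤-Reasoning

      Boundary : Pred V 0ℓ
      Boundary r = ¬ X₂ r × (X₂ r ⊎ p₂ ≡ r ⊎ q₂ ≡ r)
      p-near : Boundary p₂
      p-near = X₂.p∉ , inj₂ (inj₁ refl)
      q-near : Boundary q₂
      q-near = X₂.q∉ , inj₂ (inj₂ refl)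

      Cov-nbr : ∀ {s t} → Unc s → E s t → Cov t
      Cov-nbr {s} {t} ¬Cs st = decidable-stable (cov? t) λ ¬Ct → uncovered-independent ¬Cs ¬Ct st

      module _ {s} (¬Cs : Unc s) (s≁X₂ : ∀ {x} → X₂ x → ¬ E s x) where

        nbr⊆ : ∀ {t} → E s t → (X₁ ∪ Z) t
        nbr⊆ {t} st with X₁.X? t
        ... | yes t₁ = inj₁ t₁
        ... | no ¬t₁ = inj₂ (Cov-nbr ¬Cs st , ¬t₁ , λ t₂ → s≁X₂ t₂ st)

        -- At most 2 (1 + k) - k = 2 + k vertices are left for `X₁` and `Z`, and all neighbours of
        -- `s`, at least 2 + k, are among them.
        adjacent-to-all : ∀ {t} → (X₁ ∪ Z) t → E s t
        adjacent-to-all {t} t∈ = decidable-stable (E? s t) λ ¬st → 1+n≰n (begin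
          suc ((1 + k) + (1 + k)) ≡⟨ eq k ⟩
          k + (3 + k)             ≤⟨ +-mono-≤ k≤X₂ (≤-trans (s≤s (degree-Unc ¬Cs))
                                       (#-insert (E? s) X₁∪Z? t nbr⊆ t∈ ¬st)) ⟩
          # X₂.X? + # X₁∪Z?       ≤⟨ #X₂+#X₁∪Z≤ ⟩
          (1 + k) + (1 + k)       ∎)
          where
          eq : ∀ k → suc ((1 + k) + (1 + k)) ≡ k + (3 + k)
          eq = solve-∀

      u~ : ∀ {t} → (X₁ ∪ Z) t → E u t
      u~ = adjacent-to-all ¬Cu u≁X₂

      X₂-small : 1 + k ≤ # X₂.X? → ⊥
      X₂-small 1+k≤ = 1+n≰n (begin
        suc ((1 + k) + (1 + k)) ≡⟨ sym (+-suc (1 + k) (1 + k)) ⟩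
        (1 + k) + (2 + k)       ≤⟨ +-mono-≤ 1+k≤ (≤-trans (degree-Unc ¬Cu) (#-mono (E? u) X₁∪Z? (nbr⊆ ¬Cu u≁X₂))) ⟩
        # X₂.X? + # X₁∪Z?       ≤⟨ #X₂+#X₁∪Z≤ ⟩
        (1 + k) + (1 + k)       ∎)

      -- `X₂` has at most k vertices, so `x`, of degree at least 1 + k, misses only itself in `X₂`
      -- and its boundary.
      X₂-complete : ∀ {x t} → X₂ x → x ≢ t → X₂ t ⊎ p₂ ≡ t ⊎ q₂ ≡ t → E x t
      X₂-complete {x} {t} x₂ x≢t t∈ = decidable-stable (E? x t) λ ¬xt → X₂-small (size₁ end₂ x₂ x≢t t∈ ¬xt)

      X₂~boundary : ∀ {x r} → X₂ x → Boundary r → E x r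
      X₂~boundary x₂ (¬r₂ , r∈) = X₂-complete x₂ (λ { refl → ¬r₂ x₂ }) r∈

      b∉X₁ : ¬ X₁ b
      b∉X₁ b₁ = y∉ (proj₁ (X₁⊆ b₁))

      Zb : Z b
      Zb = Cov-nbr ¬Cu ub , b∉X₁ , λ b₂ → proj₁ (proj₂ (X₂⊆ b₂)) refl

      -- `u` sees all of `X₁`, and edges at the free end `X₂` are non-critical, so an edge from `s`
      -- to `y` would complete a cross exchange.
      crossing⇒uncovered≁ : ∀ {x y s} → Mate x y → X₁ x → X₂ y → Unc s → u ≢ s → ¬ E s y
      crossing⇒uncovered≁ xy x₁ y₂ ¬Cs u≢s sy = let Ax , _ , x≢w = X₁⊆ x₁ ; ¬Ay , _ , y≢w = X₂⊆ y₂ in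
        no-crossExchange xy ¬Cu ¬Cs u≢s ub cut Ax ¬Ay x≢w y≢w (u~ (inj₁ x₁)) sy
          (critᵤ (u~ (inj₁ x₁)) (λ { refl → b∉X₁ x₁ })) (NonCritical-sym (free₂ y₂ (E-sym sy)))

      boundary-Z : ∀ {x y r} → Mate x y → X₁ x → X₂ y → Boundary r → Z r
      boundary-Z {r = r} xy x₁ y₂ near =
        decidable-stable (cov? r) (λ ¬Cr →
          crossing⇒uncovered≁ xy x₁ y₂ ¬Cr (λ { refl → u≁X₂ y₂ (E-sym yr) }) (E-sym yr)) ,
        (λ r₁ → X₁-X₂ y₂ r₁ (E-sym yr)) , proj₁ near
        where yr = X₂~boundary y₂ near

      main : Z p₂ → Z q₂ → ⊥
      main Zp Zq = v-side (A? v) (v ≟ w)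
        where
        p≢q : p₂ ≢ q₂
        p≢q = End-≢ end₂

        -- A third vertex of `Z` would make 2 k + 3 covered vertices.
        Z⊆boundary : ∀ {z} → Z z → p₂ ≡ z ⊎ q₂ ≡ z
        Z⊆boundary {z} Zz = decidable-stable (pair? p₂ q₂ z) λ z∉ → 1+n≰n (begin
          suc ((1 + k) + (1 + k)) ≡⟨ eq k ⟩
          k + (k + 3)             ≤⟨ +-mono-≤ k≤X₂ (≤-trans (+-mono-≤ k≤X₁ (≤-trans
                                       (#-triple≥ p≢q (z∉ ∘ inj₁) (z∉ ∘ inj₂))
                                       (#-mono (triple? p₂ q₂ z) Z? λ
                                         { (inj₁ refl) → Zp ; (inj₂ (inj₁ refl)) → Zq ; (inj₂ (inj₂ refl)) → Zz })))
                                       #X₁+#Z≤) ⟩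
          # X₂.X? + # X₁∪Z?       ≤⟨ #X₂+#X₁∪Z≤ ⟩
          (1 + k) + (1 + k)       ∎)
          where
          eq : ∀ k → suc ((1 + k) + (1 + k)) ≡ k + (k + 3)
          eq = solve-∀

        -- The mate of `y` is in `X₁`, `X₂` or `Z`; in the last case it is a boundary vertex and
        -- hence adjacent to `y` in `E`, which a mate never is.
        v≁X₂ : ∀ {y} → X₂ y → ¬ E v y
        v≁X₂ {y} y₂ vy with covered⇒mate M (X₂⊆Cov y₂)
        ... | x , yx with X₁.X? x | X₂.X? x
        ...   | yes x₁ | _ = crossing⇒uncovered≁ (swap yx) x₁ y₂ ¬Cv u≢v vy
        ...   | no _   | yes x₂ = X₂-small (internal⇒size₂ yx y₂ x₂)
        ...   | no ¬x₁ | no ¬x₂ = proj₂ (X₂-complete y₂ (mate-≢ yx)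
                (inj₂ (Z⊆boundary (mate⇒covered (swap yx) , ¬x₁ , ¬x₂)))) yx

        v~ : ∀ {t} → (X₁ ∪ Z) t → E v t
        v~ = adjacent-to-all ¬Cv v≁X₂

        -- If `r` were in `A`, its edges to `X₂` would cross the cut; if beyond, its edge to `u`
        -- would. Only u b may cross, and `b` is neither `r` nor in `X₂`.
        boundary-is-w : ∀ {r} → Boundary r → Z r → b ≢ r → r ≡ w
        boundary-is-w {r} near Zr b≢r with A? r | r ≟ w
        ... | _      | yes r≡w = r≡w
        ... | yes Ar | no r≢w = let ¬Ay , y≢b , y≢w = X₂⊆ X₂.inner∈ in
          contradiction (proj₂ (only Ar ¬Ay r≢w y≢w (E-sym (X₂~boundary X₂.inner∈ near)))) y≢b
        ... | no ¬Ar | no r≢w = contradiction (sym (proj₂ (only x∈ ¬Ar x≢z r≢w (u~ (inj₂ Zr))))) b≢r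

        -- At most one of `p₂` and `q₂` is `b`, so the other is `w`.
        Cw : Cov w
        Cw with b ≟ p₂
        ... | yes refl = subst Cov (boundary-is-w q-near Zq p≢q) (proj₁ Zq)
        ... | no b≢p   = subst Cov (boundary-is-w p-near Zp b≢p) (proj₁ Zp)

        -- In `A`, the edge from `v` to `b` crosses the cut; beyond it, an edge from `v` to `X₁`
        -- does. Neither is u b.
        v-side : Dec (A v) → Dec (v ≡ w) → ⊥
        v-side _ (yes refl) = ¬Cv Cw
        v-side (yes Av) (no v≢w) = u≢v (sym (proj₁ (only Av y∉ v≢w y≢z (v~ (inj₂ Zb)))))
        v-side (no ¬Av) (no v≢w) = let Ax , x≢u , x≢w = X₁⊆ X₁.inner∈ in
          x≢u (proj₁ (only Ax ¬Av x≢w v≢w (E-sym (v~ (inj₁ X₁.inner∈)))))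

  -- At most 2 (1 + k) of the at least 2 (2 + k) vertices are covered, which leaves two uncovered.
  -- By `no-critical` neither has a critical edge, against `at-most-one-uncritical`.
  impossible : ⊥
  impossible with #-exceeds {n} {U} U? cov? few₁
    where
    few₁ : # cov? < # {n} {U} U?
    few₁ = ≤-trans (s≤s #Cov≤) (≤-trans (s≤s (+-monoʳ-≤ (1 + k) (n≤1+n _)))
             (≤-trans order (≤-reflexive (sym (#-U {n})))))
  ... | u , _ , ¬Cu with #-exceeds {n} {U} U? cov∪u? few₂
    where
    cov∪u? : Decidable (λ x → u ≡ x ⊎ Cov x)
    cov∪u? x = u ≟ x ⊎-dec cov? x
    few₂ : # cov∪u? < # {n} {U} U?
    few₂ = begin-strict
      # cov∪u?                  ≤⟨ #-∪ cov∪u? (u ≟_) cov? id ⟩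
      # (u ≟_) + # cov?         ≤⟨ +-mono-≤ (#-｛｝ u) #Cov≤ ⟩
      1 + ((1 + k) + (1 + k))   ≡⟨ sym (+-suc (1 + k) (1 + k)) ⟩
      (1 + k) + (2 + k)         <⟨ n<1+n _ ⟩
      (2 + k) + (2 + k)         ≤⟨ order ⟩
      n                         ≡⟨ sym (#-U {n}) ⟩
      # {n} {U} U?              ∎
      where open ≤-Reasoning
  ...   | v , _ , v∉ = ¬¬-excluded-middle {A = ∃[ b ] E u b × ¬ NC u b} λ where
          (yes (b , ub , ¬nc)) → no-critical ¬Cu ¬Cv u≢v ub ¬nc
          (no ∄u) → ¬¬-excluded-middle {A = ∃[ b ] E v b × ¬ NC v b} λ where
            (yes (b , vb , ¬nc)) → no-critical ¬Cv ¬Cu (u≢v ∘ sym) vb ¬nc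
            (no ∄v) → at-most-one-uncritical ¬Cu ¬Cv u≢v
              (λ {t} ut _ → NonCritical-stable λ ¬nc → ∄u (t , ut , ¬nc))
              (λ {t} vt (_ : v ≢ t) → NonCritical-stable λ ¬nc → ∄v (t , vt , ¬nc))
    where
    ¬Cv : Unc v
    ¬Cv = v∉ ∘ inj₂
    u≢v : u ≢ v
    u≢v = v∉ ∘ inj₁

-- Paths and cuts, exhaustive search, complete graphs

module _ {n : ℕ} where

  private V = Fin n

  Off : Rel V 0ℓ → V → Rel V 0ℓ
  Off E z s t = s ≢ z × t ≢ z × E s t

  module _ {E : Rel V 0ℓ} where

    Star-NoCross : ∀ {z P s t} → Decidable P → NoCross E z P → Star (Off E z) s t → P s → P t
    Star-NoCross P? nx ε Ps = Ps
    Star-NoCross {P = P} P? nx (_◅_ {j = r} (s≢z , r≢z , e) path) Ps =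
      Star-NoCross P? nx path (decidable-stable (P? r) λ ¬Pr → nx Ps ¬Pr s≢z r≢z e)

  module _ (G : Graph n) where

    private E = Adj G

    -- Deleting no vertex is left out: with more than two vertices it follows by deleting one other
    -- than `u` and `v`.
    Conn₂ : Set
    Conn₂ = ∀ z u v → u ≢ z → v ≢ z → Star (Off E z) u v

    Conn₂⇒TwoConn : Conn₂ → TwoConn E
    Conn₂⇒TwoConn c z P? {a} {b} Pa ¬Pb a≢z b≢z nx = ¬Pb (Star-NoCross P? nx (c z a b a≢z b≢z) Pa)

    -- The set `P` of vertices reached from `u` grows by one at a time; once no edge leaves it off
    -- `z`, it decides the question. `fuel` bounds the number of vertices still missing.
    reachable? : ∀ z u v → Dec (Star (Off E z) u v)
    reachable? z u v = grow n (u ≟_) refl (λ { refl → ε }) (m≤n+m n _)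
      where
      grow : ∀ fuel {P : Pred V 0ℓ} (P? : Decidable P) → P u → (∀ {x} → P x → Star (Off E z) u x) →
             n ≤ # P? + fuel → Dec (Star (Off E z) u v)
      grow fuel {P} P? Pu reach n≤ with P? v
      ... | yes Pv = yes (reach Pv)
      grow zero P? Pu reach n≤ | no ¬Pv = contradiction
        (≤-trans (#-insert P? U? v _ _ ¬Pv)
          (≤-trans (≤-reflexive (#-U {n})) (≤-trans n≤ (≤-reflexive (+-identityʳ _))))) 1+n≰n
      grow (suc fuel) {P} P? Pu reach n≤ | no ¬Pv
        with any? (λ s → any? (λ t → P? s ×-dec ¬? (P? t) ×-dec ¬? (s ≟ z) ×-dec ¬? (t ≟ z) ×-dec adj? G s t))
      ... | no ∄ = no λ path → ¬Pv (Star-NoCross P?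
              (λ Ps ¬Pt s≢z t≢z e → ∄ (_ , _ , Ps , ¬Pt , s≢z , t≢z , e)) path Pu)
      ... | yes (s , t , Ps , ¬Pt , s≢z , t≢z , e) = grow fuel P∪t? (inj₁ Pu)
              (λ { (inj₁ Px) → reach Px ; (inj₂ refl) → reach Ps ◅◅ ((s≢z , t≢z , e) ◅ ε) })
              (≤-trans n≤ (≤-trans (≤-reflexive (+-suc (# P?) fuel))
                (+-monoˡ-≤ fuel (#-insert P? P∪t? t inj₁ (inj₂ refl) ¬Pt))))
        where
        P∪t? : Decidable (λ x → P x ⊎ t ≡ x)
        P∪t? x = P? x ⊎-dec t ≟ x

    -- If `v` were unreachable, the vertices reachable from `u` would form a decidable cut.
    TwoConn⇒Conn₂ : TwoConn E → Conn₂
    TwoConn⇒Conn₂ tc z u v u≢z v≢z = decidable-stable (reachable? z u v) λ ¬path →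
      tc z (reachable? z u) ε ¬path u≢z v≢z λ path ¬path′ s≢z t≢z e →
        ¬path′ (path ◅◅ ((s≢z , t≢z , e) ◅ ε))

    Conn₂? : Dec Conn₂
    Conn₂? = all? λ z → all? λ u → all? λ v → ¬? (u ≟ z) →-dec ¬? (v ≟ z) →-dec reachable? z u v

    IsConnected⇒TwoConn : IsConnected[ 2 ] G → TwoConn E
    IsConnected⇒TwoConn (_ , conn) = Conn₂⇒TwoConn λ z u v u≢z v≢z →
      Star.map (λ (s∉ , t∉ , e) → (λ { refl → s∉ z∈ }) , (λ { refl → t∉ z∈ }) , e)
        (conn ⁅ z ⁆ (s≤s (≤-reflexive (∣⁅x⁆∣≡1 z))) u v (u≢z ∘ x∈⁅y⁆⇒x≡y z) (v≢z ∘ x∈⁅y⁆⇒x≡y z))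
      where
      z∈ : ∀ {z : V} → z ∈ˢ ⁅ z ⁆
      z∈ = x∈⁅x⁆ _

    Conn₂⇒IsConnected : 2 < n → Conn₂ → IsConnected[ 2 ] G
    Conn₂⇒IsConnected 2<n c = 2<n , connected
      where
      connected : ∀ S → ∣ S ∣ < 2 → ConnectedOff G S
      connected S ∣S∣<2 u v u∉ v∉ with nonempty? S
      ... | yes (z , z∈) = Star.map (λ (s≢z , t≢z , e) → s≢z ∘ only , t≢z ∘ only , e)
              (c z u v (λ { refl → u∉ z∈ }) (λ { refl → v∉ z∈ }))
        where
        only : ∀ {s} → s ∈ˢ S → s ≡ z
        only {s} s∈ = decidable-stable (s ≟ z) λ s≢z → <⇒≱ ∣S∣<2
          (≤-trans (s≤s (≤-trans (s≤s z≤n) (x∈p⇒∣p-x∣<∣p∣ (x∈p∧x≢y⇒x∈p-y s∈ s≢z)))) (x∈p⇒∣p-x∣<∣p∣ z∈))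
      ... | no S-empty with #-exceeds {n} {U} U? (pair? u v)
                               (≤-trans (s≤s (#-pair≤ u v)) (≤-trans 2<n (≤-reflexive (sym (#-U {n})))))
      ...   | z , _ , z∉ = Star.map (λ (_ , _ , e) → (λ s∈ → S-empty (_ , s∈)) , (λ t∈ → S-empty (_ , t∈)) , e)
              (c z u v (z∉ ∘ inj₁) (z∉ ∘ inj₂))

  -- Makes the existence of a removable matching of given size decidable, so that refuting
  -- maximality produces an actual matching.
  anyList? : ∀ m {P : Pred (List (Pair n)) 0ℓ} → Decidable P → Dec (∃[ M ] length M ≡ m × P M)
  anyList? zero    P? = map′ (λ P[] → [] , refl , P[]) (λ { ([] , _ , P[]) → P[] }) (P? [])
  anyList? (suc m) P? = map′
    (λ (a , b , M , ≡m , PM) → (a , b) ∷ M , cong suc ≡m , PM)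
    (λ { ((a , b) ∷ M , refl , PM) → a , b , M , refl , PM })
    (any? λ a → any? λ b → anyList? m (λ M → P? ((a , b) ∷ M)))

  isMatching? : (G : Graph n) → Decidable (IsMatching G)
  isMatching? G M = All.all? (λ (a , b) → adj? G a b) M ×-dec allPairs? disjoint? M
    where
    disjoint? : ∀ p q → Dec (Disjoint p q)
    disjoint? (a , b) (c , d) = ¬? (a ≟ c) ×-dec ¬? (a ≟ d) ×-dec ¬? (b ≟ c) ×-dec ¬? (b ≟ d)

  -- Induction on m. The next matching need not contain the previous one; if no removable matching
  -- had one edge more, `MaximalMatching.impossible` would apply.
  removable : ∀ {k} → 3 ≤ k → (G : Graph n) → IsConnected[ 2 ] G → (2 + k) + (2 + k) ≤ n → MinDegree≥ (2 + k) G →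
              ∀ m → m ≤ 2 + k → ∃[ M ] length M ≡ m × IsMatching G M × Conn₂ (G -ᴱ M)
  removable 3≤k G conn order minDeg zero _ = [] , refl , ([] , []) ,
    TwoConn⇒Conn₂ (G -ᴱ []) (TwoConn-mono (λ e → e , λ { (inj₁ ()) ; (inj₂ ()) }) (IsConnected⇒TwoConn G conn))
  removable {k} 3≤k G conn order minDeg (suc m) m<2+k with removable 3≤k G conn order minDeg m (<⇒≤ m<2+k)
  ... | M , refl , isM , c = decidable-stable
    (anyList? (suc (length M)) (λ M′ → isMatching? G M′ ×-dec Conn₂? (G -ᴱ M′)))
    λ ∄ → MaximalMatching.impossible 3≤k G M isM (≤-pred m<2+k) order minDeg (Conn₂⇒TwoConn (G -ᴱ M) c)
      λ M′ isM′ ≡suc tc → ∄ (M′ , ≡suc , isM′ , TwoConn⇒Conn₂ (G -ᴱ M′) tc)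

  complete : Graph n
  complete = record
    { Adj = _≢_ ; adj? = λ u v → ¬? (u ≟ v) ; adj-sym = λ u≢v → u≢v ∘ sym ; adj-irrefl = λ v≢v → v≢v refl }

  matching-size : ∀ {G : Graph n} {M} → IsMatching G M → length M + length M ≤ n
  matching-size {G} {M} (adj , disj) = begin
    length M + length M  ≡⟨ sym (length-ends M) ⟩
    length (ends M)      ≡⟨ sym (count-all (ends M)) ⟩
    count U? (ends M)    ≤⟨ count≤# U? (ends-unique (All.map (λ { e refl → adj-irrefl G e }) adj) disj) ⟩
    # {n} {U} U?         ≡⟨ #-U ⟩
    n                    ∎
    where open ≤-Reasoning

corollary1p2 : ∀ (d : ℕ) → 5 ≤ d → f[ 2 , d ]≡ d
corollary1p2 d@(suc (suc k)) (s≤s (s≤s 3≤k)) = lower , upper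
  where
  lower : AlwaysRemovable 2 d d
  lower {n} G conn order minDeg =
    let M , ≡d , isM , c = removable 3≤k G conn (subst (_≤ n) (cong (d +_) (+-identityʳ d)) order) minDeg d ≤-refl
    in M , isM , ≡d , Conn₂⇒IsConnected (G -ᴱ M) (proj₁ conn) c

  upper : ∀ m → AlwaysRemovable 2 d m → m ≤ d
  upper m always = ≮⇒≥ λ d<m → <⇒≱ (+-mono-< d<m d<m)
    (subst (λ m → m + m ≤ d + d) ≡m
      (subst (length M + length M ≤_) (cong (d +_) (+-identityʳ d)) (matching-size {G = K} isM)))
    where
    K : Graph (2 * d)
    K = complete
    2<2d : 2 < 2 * d
    2<2d = s≤s (s≤s (≤-trans (≤-trans (s≤s z≤n) 3≤k) (m≤m+n k _)))
    K-connected : IsConnected[ 2 ] K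
    K-connected = Conn₂⇒IsConnected K 2<2d λ z u v u≢z v≢z → case u ≟ v of λ where
      (yes refl) → ε
      (no u≢v)   → (u≢z , v≢z , u≢v) ◅ ε
    K-degree : MinDegree≥ d K
    K-degree v = ≤-pred (begin
      suc d              ≡⟨ +-comm 1 d ⟩
      d + 1              ≤⟨ +-monoʳ-≤ d (s≤s z≤n) ⟩
      2 * d              ≡⟨ sym (#-U {2 * d}) ⟩
      # {2 * d} {U} U?   ≤⟨ #-delete U? (adj? K v) v (λ _ v≢y → v≢y) ⟩
      suc (degree K v)   ∎)
      where open ≤-Reasoning
    found = always K K-connected ≤-refl K-degree
    M = proj₁ found
    isM = proj₁ (proj₂ found)
    ≡m = proj₁ (proj₂ (proj₂ found))
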